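{- Let $P,Q\in\mathbb Z$, $Q\ne0$, $f(t)=t^2-Pt+Q$, $D=P^2-4Q\ne0$, and let $p$ be a prime with $p\nmid Q$. Let $G^*(f)$ be Laxton's group with subgroups $G^*(f,p)_L,K^*(f,p)_L,H^*(f,p)_L$, and let $G^*_{\mathbb Q}(f)$ with subgroups $G^*(f,p),K^*(f,p),H^*(f,p)$ be as in the context. Under the natural group isomorphism $\iota:G^*(f)\to G^*_{\mathbb Q}(f)$, $\mathcal W\mapsto\mathcal W$, we have $\iota(G^*(f,p)_L)=G^*(f,p)$, $\iota(K^*(f,p)_L)=K^*(f,p)$ and $\iota(H^*(f,p)_L)=H^*(f,p)$. Moreover there is an exact sequence of groups $$1\to G^*(f,p)\to K^*(f,p)\xrightarrow{\mathrm{red}_p}G^*_{\mathbb F_p}(f)\to1,$$ where $\mathrm{red}_p[w_1:w_0]=[w_1\bmod p:w_0\bmod p]$ for a representative with $w_0,w_1\in\mathbb Z$ coprime.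
   Context: For an integral domain $R$ with $Q\in R^\times$: $\mathscr S(f,R)^{\times}$ is the set of sequences $(w_n)_{n\in\mathbb Z}$ in $R$ with $w_{n+2}-Pw_{n+1}+Qw_n=0$ and $\Lambda(w_1,w_0):=w_1^2-Pw_0w_1+Qw_0^2\in R^{\times}$, a group under $(w_n)*(v_n)=(u_n)$, $u_1=w_1v_1-Qw_0v_0$, $u_0=w_0v_1+w_1v_0-Pw_0v_0$. $G_R(f)$ is its quotient by ${\bf w}\sim{\bf v}\iff w_n=\lambda v_n\ \forall n$ ($\lambda\in R^\times$), and $G^*_R(f)$ its quotient by ${\bf w}\sim^*{\bf v}\iff w_n=\lambda v_{n+\nu}\ \forall n$ ($\lambda\in R^\times,\nu\in\mathbb Z$); $[w_1:w_0]$ denotes the class of the sequence with initial terms $w_1,w_0$; $\pi:G_{\mathbb Q}(f)\to G^*_{\mathbb Q}(f)$ is the natural surjection. Laxton's group $G^*(f)$: the set of rational sequences $(w_n)$ satisfying the recurrence, with $\Lambda(w_1,w_0)\ne0$ and $w_k\in\mathbb Z$ for all $k\ge\nu$ for some $\nu$, modulo $\sim^*$ over $\mathbb Q$, with the same product. Say $p\mid{\bf w}$ if $w_n\in p\mathbb Z_{(p)}$ for some $n$. $G^*(f,p)_L=\{\mathcal W: p\mid{\bf w}\text{ for all }{\bf w}\in\mathcal W\}$; $K^*(f,p)_L=\{\mathcal W:\exists {\bf w}\in\mathcal W$ with $w_0,w_1\in\mathbb Z$, $p\nmid\Lambda(w_1,w_0)\}$; $H^*(f,p)_L=\{\mathcal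 W:\mathcal W^n\in G^*(f,p)_L$ for some nonzero $n\in\mathbb Z\}$. The reduction $\mathrm{red}_p:G_{\mathbb Q}(f)\to\mathbb P^1(\mathbb F_p)$ sends $[w_1:w_0]$, with $w_0,w_1\in\mathbb Z$ coprime, to $[w_1:w_0]\bmod p$; $G_{\mathbb F_p}(f)\subset\mathbb P^1(\mathbb F_p)$. Define $G(f,p)=\{x\in G_{\mathbb Q}(f):\mathrm{red}_p(x)=[1:0]\}$, $K(f,p)=\{x:\mathrm{red}_p(x)\in G_{\mathbb F_p}(f)\}$, $H(f,p)=\{x:\mathrm{red}_p(x^n)=[1:0]\text{ for some nonzero } n\in\mathbb Z\}$, and $G^*(f,p)=\pi(G(f,p))$, $K^*(f,p)=\pi(K(f,p))$, $H^*(f,p)=\pi(H(f,p))$. -}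

module Defs where

open import Data.Nat using (ℕ; zero; suc)
open import Data.Integer as ℤ using (ℤ; +_; -[1+_])
open import Data.Integer.Divisibility using (_∣_)
open import Data.Integer.Coprimality using (Coprime)
open import Data.Rational as ℚ using (ℚ; 0ℚ; 1ℚ; ↥_)
open import Data.Product using (Σ; ∃; ∃-syntax; _×_; _,_)
open import Relation.Binary.PropositionalEquality using (_≡_; _≢_)
open import Relation.Nullary using (¬_)

ι : ℤ → ℚ
ι z = z ℚ./ 1

IsInt : ℚ → Set
IsInt q = ∃[ z ] q ≡ ι z

-- Throughout, P Q are the coefficients of f(t) = t² - P t + Q.
-- An element of 𝒮(f,ℚ) is a sequence w : ℤ → ℚ (indexed by all n ∈ ℤ).
module _ (P Q : ℤ) where

  Pq Qq : ℚ
  Pq = ι P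
  Qq = ι Q

  Λ : ℚ → ℚ → ℚ
  Λ w₁ w₀ = (w₁ ℚ.* w₁ ℚ.- Pq ℚ.* w₀ ℚ.* w₁) ℚ.+ Qq ℚ.* w₀ ℚ.* w₀

  Λℤ : ℤ → ℤ → ℤ
  Λℤ a₁ a₀ = (a₁ ℤ.* a₁ ℤ.- P ℤ.* a₀ ℤ.* a₁) ℤ.+ Q ℤ.* a₀ ℤ.* a₀

  IsSeq : (ℤ → ℚ) → Set
  IsSeq w = ∀ n → (w (n ℤ.+ + 2) ℚ.- Pq ℚ.* w (n ℤ.+ + 1)) ℚ.+ Qq ℚ.* w n ≡ 0ℚ

  Elem : (ℤ → ℚ) → Set
  Elem w = IsSeq w × Λ (w (+ 1)) (w (+ 0)) ≢ 0ℚ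

  mulInit : ℚ × ℚ → ℚ × ℚ → ℚ × ℚ
  mulInit (w₁ , w₀) (v₁ , v₀) =
    (w₁ ℚ.* v₁ ℚ.- Qq ℚ.* w₀ ℚ.* v₀ , (w₀ ℚ.* v₁ ℚ.+ w₁ ℚ.* v₀) ℚ.- Pq ℚ.* w₀ ℚ.* v₀)

  init : (ℤ → ℚ) → ℚ × ℚ
  init w = (w (+ 1) , w (+ 0))

  Prod : (ℤ → ℚ) → (ℤ → ℚ) → (ℤ → ℚ) → Set
  Prod w v u = init u ≡ mulInit (init w) (init v)

  IsOne : (ℤ → ℚ) → Set
  IsOne u = init u ≡ (1ℚ , 0ℚ)

  PowN : (ℤ → ℚ) → ℕ → (ℤ → ℚ) → Set
  PowN w zero u = IsOne u
  PowN w (suc n) u = ∃[ u' ] (IsSeq u' × PowN w n u' × Prod u' w u)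

  Pow : (ℤ → ℚ) → ℤ → (ℤ → ℚ) → Set
  Pow w (+ n) u = PowN w n u
  Pow w -[1+ n ] u = ∃[ u' ] (IsSeq u' × PowN w (suc n) u' × mulInit (init u') (init u) ≡ (1ℚ , 0ℚ))

  Sim : (ℤ → ℚ) → (ℤ → ℚ) → Set
  Sim w v = ∃[ λ' ] (λ' ≢ 0ℚ × ∀ n → w n ≡ λ' ℚ.* v n)

  -- 𝐰 ∼* 𝐯  (same class in G*_ℚ(f), and in Laxton's G*(f))
  SimStar : (ℤ → ℚ) → (ℤ → ℚ) → Set
  SimStar w v = ∃[ λ' ] (λ' ≢ 0ℚ × ∃[ ν ] ∀ n → w n ≡ λ' ℚ.* v (n ℤ.+ ν))

  Laxton : (ℤ → ℚ) → Set
  Laxton w = Elem w × ∃[ ν ] (∀ k → ν ℤ.≤ k → IsInt (w k))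

  module _ (p : ℕ) where

    -- p ∣ 𝐰 : some w_n ∈ pℤ_(p)  (numerator of the reduced fraction divisible by p)
    PDiv : (ℤ → ℚ) → Set
    PDiv w = ∃[ n ] (+ p ∣ (↥ w n))

    GL : (ℤ → ℚ) → Set
    GL w = ∀ v → Laxton v → SimStar v w → PDiv v

    KL : (ℤ → ℚ) → Set
    KL w = ∃[ v ] (Laxton v × SimStar v w ×
             ∃[ a₁ ] ∃[ a₀ ] (v (+ 1) ≡ ι a₁ × v (+ 0) ≡ ι a₀ × ¬ (+ p ∣ Λℤ a₁ a₀)))

    HL : (ℤ → ℚ) → Set
    HL w = ∃[ n ] (n ≢ + 0 × ∃[ u ] (IsSeq u × Pow w n u × GL u))

    CoprimeRep : (ℤ → ℚ) → ℤ → ℤ → Set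
    CoprimeRep w c₁ c₀ = ∃[ λ' ] (λ' ≢ 0ℚ × λ' ℚ.* w (+ 1) ≡ ι c₁ × λ' ℚ.* w (+ 0) ≡ ι c₀)
                         × Coprime c₁ c₀

    -- equality of points [a₁ : a₀] = [b₁ : b₀] in ℙ¹(𝔽_p) (integer representatives)
    ProjEq : ℤ × ℤ → ℤ × ℤ → Set
    ProjEq (a₁ , a₀) (b₁ , b₀) = + p ∣ (a₁ ℤ.* b₀ ℤ.- a₀ ℤ.* b₁)

    RedIs : (ℤ → ℚ) → ℤ × ℤ → Set
    RedIs w a = ∃[ c₁ ] ∃[ c₀ ] (CoprimeRep w c₁ c₀ × ProjEq (c₁ , c₀) a)

    InGFp : ℤ × ℤ → Set
    InGFp (a₁ , a₀) = ¬ (+ p ∣ Λℤ a₁ a₀)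

    InG : (ℤ → ℚ) → Set
    InG w = RedIs w (+ 1 , + 0)

    InK : (ℤ → ℚ) → Set
    InK w = ∃[ c₁ ] ∃[ c₀ ] (CoprimeRep w c₁ c₀ × InGFp (c₁ , c₀))

    InH : (ℤ → ℚ) → Set
    InH w = ∃[ n ] (n ≢ + 0 × ∃[ u ] (IsSeq u × Pow w n u × InG u))

    -- G*(f,p) = π(G(f,p)), etc.: the class of w contains a representative in the subset
    InGStar InKStar InHStar : (ℤ → ℚ) → Set
    InGStar w = ∃[ v ] (Elem v × SimStar v w × InG v)
    InKStar w = ∃[ v ] (Elem v × SimStar v w × InK v)
    InHStar w = ∃[ v ] (Elem v × SimStar v w × InH v)

    -- G*_{𝔽_p}(f): sequences over 𝔽_p, represented by integer sequences mod p

    IsSeqFp : (ℤ → ℤ) → Set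
    IsSeqFp r = ∀ n → + p ∣ ((r (n ℤ.+ + 2) ℤ.- P ℤ.* r (n ℤ.+ + 1)) ℤ.+ Q ℤ.* r n)

    ElemFp : (ℤ → ℤ) → Set
    ElemFp r = IsSeqFp r × ¬ (+ p ∣ Λℤ (r (+ 1)) (r (+ 0)))

    SimStarFp : (ℤ → ℤ) → (ℤ → ℤ) → Set
    SimStarFp r s = ∃[ λ' ] (¬ (+ p ∣ λ') × ∃[ ν ] ∀ n → + p ∣ (r n ℤ.- λ' ℤ.* s (n ℤ.+ ν)))

    ProdFp : (ℤ → ℤ) → (ℤ → ℤ) → (ℤ → ℤ) → Set
    ProdFp r s t =
      + p ∣ (t (+ 1) ℤ.- (r (+ 1) ℤ.* s (+ 1) ℤ.- Q ℤ.* r (+ 0) ℤ.* s (+ 0))) ×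
      + p ∣ (t (+ 0) ℤ.- ((r (+ 0) ℤ.* s (+ 1) ℤ.+ r (+ 1) ℤ.* s (+ 0)) ℤ.- P ℤ.* r (+ 0) ℤ.* s (+ 0)))

    IsOneFp : (ℤ → ℤ) → Set
    IsOneFp e = + p ∣ (e (+ 1) ℤ.- + 1) × + p ∣ e (+ 0)

    RedSeq : (ℤ → ℚ) → (ℤ → ℤ) → Set
    RedSeq w r = IsSeqFp r × ∃[ c₁ ] ∃[ c₀ ] (CoprimeRep w c₁ c₀ ×
                   + p ∣ (r (+ 1) ℤ.- c₁) × + p ∣ (r (+ 0) ℤ.- c₀))

    TrivFp : (ℤ → ℤ) → Set
    TrivFp r = ∃[ e ] (IsSeqFp e × IsOneFp e × SimStarFp r e)

{-# OPTIONS --safe #-}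
-- Scale x so that its initial terms become coprime integers, and call the result C.
-- Since p ∤ Q the recurrence can be run in both directions over ℤ₍ₚ₎, so all terms of C
-- are p-integral, C is determined modulo p by any two consecutive terms, and no two
-- consecutive terms vanish modulo p.  Both G*(f,p)_L and G*(f,p) then consist of the
-- classes for which p divides some term of C, and K*(f,p) of those with a
-- representative having p ∤ Λ(C₁ , C₀).  If 𝒲ⁿ lies in G*(f,p)_L, its normalised initial pair
-- is a unit modulo p, hence has finite order there, so a further power reduces to [1:0];
-- this gives H.  Two sequences over 𝔽ₚ with nonzero initial pairs are proportional as
-- soon as the determinant of the pairs vanishes, which gives the statements on red_p.
module Submission where

open import Defs
open import Data.Fin using (Fin; fromℕ<; toℕ; combine)
import Data.Fin.Properties as Finₚ
open import Data.Integer as ℤ using (ℤ; +_; -[1+_]; ∣_∣)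
open import Data.Integer.Coprimality using (Coprime)
open import Data.Integer.DivMod using (_%ℕ_; _/ℕ_; n%ℕd<d; a≡a%ℕn+[a/ℕn]*n)
open import Data.Integer.Divisibility using (_∣_)
open import Data.Integer.Divisibility.Signed as Signed using (divides; ∣ᵤ⇒∣; ∣⇒∣ᵤ)
import Data.Integer.Properties as ℤₚ
import Data.Integer.Tactic.RingSolver as ℤ-Solver
open import Data.Nat as ℕ using (ℕ; zero; suc)
open import Data.Nat.Coprimality as ℕC using (coprime-Bézout)
import Data.Nat.Divisibility as ℕ∣
open import Data.Nat.GCD using (module Bézout)
open import Data.Nat.Primality using (Prime; euclidsLemma; prime⇒irreducible; prime⇒nonTrivial; prime⇒nonZero)
import Data.Nat.Properties as ℕₚ
open import Data.Product using (∃-syntax; _×_; _,_; proj₁; proj₂)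
open import Data.Rational as ℚ using (ℚ; 0ℚ; 1ℚ; ↥_; ↧_; mkℚ; toℚᵘ; _+_; _*_; _-_; -_)
import Data.Rational.Properties as ℚₚ
open import Data.Rational.Unnormalised as ℚᵘ using (mkℚᵘ; *≡*)
import Data.Rational.Unnormalised.Properties as ℚᵘₚ
open import Data.Sum using (_⊎_; inj₁; inj₂; [_,_]′)
open import Function using (_∘_)
open import Function.Bundles using (_⇔_; mk⇔)
open import Relation.Binary.PropositionalEquality using (_≡_; _≢_; refl; sym; trans; cong; cong₂; subst; subst₂; module ≡-Reasoning)
open import Relation.Nullary using (¬_; Dec; yes; no; contradiction)
open import Relation.Nullary.Decidable using (dec⇒maybe)
open import Tactic.RingSolver using (solve-∀)
open import Tactic.RingSolver.Core.AlmostCommutativeRing using (AlmostCommutativeRing; fromCommutativeRing)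

-- Equivalence allows rescaling and shifting, and neither need preserve coprimality of the initial
-- pair, so a change of representative forces a fresh normalisation. Instead of tracking the new
-- scalar, most arguments compare determinants: integral multiples of one pair have determinant
-- zero, and in such a relation a coefficient prime to p can be cancelled modulo p. Terms at
-- negative indices may carry powers of Q in the denominator even when the initial terms are
-- integers; congruences are therefore stated in ℤ₍ₚ₎ inside ℚ. Products are prescribed only on
-- initial pairs. They are compatible with shifts because a product is a combination, with constant
-- coefficients, of one factor and its shift. A product of coprime pairs need not be coprime, but
-- the multiplicativity of Λ keeps it nonzero modulo p when both factors have Λ prime to p.

-- Integers inside the rationals

ℚ-ring : AlmostCommutativeRing _ _
ℚ-ring = fromCommutativeRing ℚₚ.+-*-commutativeRing (λ q → dec⇒maybe (0ℚ ℚₚ.≟ q))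

toℚᵘ-ι : ∀ a → toℚᵘ (ι a) ℚᵘ.≃ mkℚᵘ a 0
toℚᵘ-ι a = ℚₚ.toℚᵘ-fromℚᵘ (mkℚᵘ a 0)

ι-injective : ∀ {a b} → ι a ≡ ι b → a ≡ b
ι-injective {a} {b} eq with ℚₚ./-injective-≃ (mkℚᵘ a 0) (mkℚᵘ b 0) eq
... | *≡* e = trans (sym (ℤₚ.*-identityʳ a)) (trans e (ℤₚ.*-identityʳ b))

ι-+ : ∀ a b → ι (a ℤ.+ b) ≡ ι a + ι b
ι-+ a b = ℚₚ.toℚᵘ-injective (begin
  toℚᵘ (ι (a ℤ.+ b))              ≈⟨ toℚᵘ-ι (a ℤ.+ b) ⟩
  mkℚᵘ (a ℤ.+ b) 0                ≈⟨ *≡* (identity a b) ⟩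
  mkℚᵘ a 0 ℚᵘ.+ mkℚᵘ b 0          ≈⟨ ℚᵘₚ.+-cong (toℚᵘ-ι a) (toℚᵘ-ι b) ⟨
  toℚᵘ (ι a) ℚᵘ.+ toℚᵘ (ι b)      ≈⟨ ℚₚ.toℚᵘ-homo-+ (ι a) (ι b) ⟨
  toℚᵘ (ι a + ι b)                ∎)
  where
  open ℚᵘₚ.≃-Reasoning
  identity : ∀ a b → (a ℤ.+ b) ℤ.* + 1 ≡ (a ℤ.* + 1 ℤ.+ b ℤ.* + 1) ℤ.* + 1
  identity = ℤ-Solver.solve-∀

ι-* : ∀ a b → ι (a ℤ.* b) ≡ ι a * ι b
ι-* a b = ℚₚ.toℚᵘ-injective (begin
  toℚᵘ (ι (a ℤ.* b))              ≈⟨ toℚᵘ-ι (a ℤ.* b) ⟩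
  mkℚᵘ (a ℤ.* b) 0                ≈⟨ *≡* refl ⟩
  mkℚᵘ a 0 ℚᵘ.* mkℚᵘ b 0          ≈⟨ ℚᵘₚ.*-cong (toℚᵘ-ι a) (toℚᵘ-ι b) ⟨
  toℚᵘ (ι a) ℚᵘ.* toℚᵘ (ι b)      ≈⟨ ℚₚ.toℚᵘ-homo-* (ι a) (ι b) ⟨
  toℚᵘ (ι a * ι b)                ∎)
  where open ℚᵘₚ.≃-Reasoning

ι-*³ : ∀ a b c → ι (a ℤ.* b ℤ.* c) ≡ ι a * ι b * ι c
ι-*³ a b c = trans (ι-* (a ℤ.* b) c) (cong (_* ι c) (ι-* a b))

ι-neg : ∀ a → ι (ℤ.- a) ≡ - ι a
ι-neg a = ℚₚ.toℚᵘ-injective (begin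
  toℚᵘ (ι (ℤ.- a))     ≈⟨ toℚᵘ-ι (ℤ.- a) ⟩
  mkℚᵘ (ℤ.- a) 0       ≈⟨ *≡* refl ⟩
  ℚᵘ.- mkℚᵘ a 0        ≈⟨ ℚᵘₚ.-‿cong (toℚᵘ-ι a) ⟨
  ℚᵘ.- toℚᵘ (ι a)      ≈⟨ ℚₚ.toℚᵘ-homo‿- (ι a) ⟨
  toℚᵘ (- ι a)         ∎)
  where open ℚᵘₚ.≃-Reasoning

ι-sub : ∀ a b → ι (a ℤ.- b) ≡ ι a - ι b
ι-sub a b = trans (ι-+ a (ℤ.- b)) (cong (_+_ (ι a)) (ι-neg b))

ι-↧↥ : ∀ q → ι (↧ q) * q ≡ ι (↥ q)
ι-↧↥ q@record{} = ℚₚ.toℚᵘ-injective (begin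
  toℚᵘ (ι (↧ q) * q)             ≈⟨ ℚₚ.toℚᵘ-homo-* (ι (↧ q)) q ⟩
  toℚᵘ (ι (↧ q)) ℚᵘ.* toℚᵘ q     ≈⟨ ℚᵘₚ.*-congʳ (toℚᵘ-ι (↧ q)) ⟩
  mkℚᵘ (↧ q) 0 ℚᵘ.* toℚᵘ q       ≈⟨ *≡* (identity (↧ q) (↥ q)) ⟩
  mkℚᵘ (↥ q) 0                   ≈⟨ toℚᵘ-ι (↥ q) ⟨
  toℚᵘ (ι (↥ q))                 ∎)
  where
  open ℚᵘₚ.≃-Reasoning
  identity : ∀ d n → (d ℤ.* n) ℤ.* + 1 ≡ n ℤ.* (+ 1 ℤ.* d)
  identity = ℤ-Solver.solve-∀

ι≢0 : ∀ {a} → a ≢ + 0 → ι a ≢ 0ℚ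
ι≢0 a≢0 eq = a≢0 (ι-injective eq)

inverse : ∀ {q} → q ≢ 0ℚ → ∃[ i ] i * q ≡ 1ℚ
inverse {q} q≢0 = ℚ.1/_ q {{nz}} , ℚₚ.*-inverseˡ q {{nz}}
  where nz = ℚ.≢-nonZero q≢0

*-cancelˡ : ∀ {q a b} → q ≢ 0ℚ → q * a ≡ q * b → a ≡ b
*-cancelˡ {q} {a} {b} q≢0 eq with inverse q≢0
... | i , iq = begin
  a              ≡⟨ ℚₚ.*-identityˡ a ⟨
  1ℚ * a         ≡⟨ cong (_* a) iq ⟨
  (i * q) * a    ≡⟨ ℚₚ.*-assoc i q a ⟩
  i * (q * a)    ≡⟨ cong (i *_) eq ⟩
  i * (q * b)    ≡⟨ ℚₚ.*-assoc i q b ⟨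
  (i * q) * b    ≡⟨ cong (_* b) iq ⟩
  1ℚ * b         ≡⟨ ℚₚ.*-identityˡ b ⟩
  b              ∎
  where open ≡-Reasoning

*-≢0 : ∀ {a b} → a ≢ 0ℚ → b ≢ 0ℚ → a * b ≢ 0ℚ
*-≢0 {a} {b} a≢0 b≢0 eq = b≢0 (*-cancelˡ a≢0 (trans eq (sym (ℚₚ.*-zeroʳ a))))

*≡1⇒≢0 : ∀ {a b} → a * b ≡ 1ℚ → a ≢ 0ℚ
*≡1⇒≢0 {a} {b} eq refl with trans (sym eq) (ℚₚ.*-zeroˡ b)
... | ()

-- Residues modulo a prime

module ModPrime (p : ℕ) (pr : Prime p) where

  Div : ℤ → Set
  Div k = + p Signed.∣ k

  Div? : ∀ k → Dec (Div k)
  Div? k = + p Signed.∣? k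

  Div-+ : ∀ {a b} → Div a → Div b → Div (a ℤ.+ b)
  Div-+ = Signed.∣m∣n⇒∣m+n

  Div-sub : ∀ {a b} → Div a → Div b → Div (a ℤ.- b)
  Div-sub = Signed.∣m∣n⇒∣m-n

  Div-*ˡ : ∀ a {b} → Div b → Div (a ℤ.* b)
  Div-*ˡ = Signed.∣n⇒∣m*n

  Div-comb : ∀ {z x y} a b → Div x → Div y → z ≡ a ℤ.* x ℤ.+ b ℤ.* y → Div z
  Div-comb a b dx dy refl = Div-+ (Div-*ˡ a dx) (Div-*ˡ b dy)

  Div-0 : Div (+ 0)
  Div-0 = divides (+ 0) refl

  ¬Div-1 : ¬ Div (+ 1)
  ¬Div-1 d = ℕₚ.<⇒≢ (ℕ.nonTrivial⇒n>1 p {{prime⇒nonTrivial pr}}) (sym (ℕ∣.∣1⇒≡1 (∣⇒∣ᵤ d)))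

  Div-euclid : ∀ a b → Div (a ℤ.* b) → Div a ⊎ Div b
  Div-euclid a b d with euclidsLemma ∣ a ∣ ∣ b ∣ pr (subst (p ℕ∣.∣_) (ℤₚ.abs-* a b) (∣⇒∣ᵤ d))
  ... | inj₁ x = inj₁ (∣ᵤ⇒∣ x)
  ... | inj₂ y = inj₂ (∣ᵤ⇒∣ y)

  Div-cancelˡ : ∀ {a b} → ¬ Div a → Div (a ℤ.* b) → Div b
  Div-cancelˡ {a} {b} ¬a d = [ (λ x → contradiction x ¬a) , (λ y → y) ]′ (Div-euclid a b d)

  ¬Div-* : ∀ {a b} → ¬ Div a → ¬ Div b → ¬ Div (a ℤ.* b)
  ¬Div-* ¬a ¬b d = ¬b (Div-cancelˡ ¬a d)

  -- Bézout's identity for p and |m|, which are coprime because p is irreducible. The coefficient of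
  -- |m| is the inverse, up to a sign that depends on its side of the identity and on the sign of m.
  inverse-mod : ∀ {m} → ¬ Div m → ∃[ h ] Div (m ℤ.* h ℤ.- + 1)
  inverse-mod {m} ¬m = signed m (coprime-Bézout coprime)
    where
    coprime : ∀ {i} → i ℕ∣.∣ p × i ℕ∣.∣ ∣ m ∣ → i ≡ 1
    coprime (i∣p , i∣m) with prime⇒irreducible pr i∣p
    ... | inj₁ i≡1 = i≡1
    ... | inj₂ refl = contradiction (∣ᵤ⇒∣ i∣m) ¬m
    unsigned : ∀ n → Bézout.Identity 1 p n → ∃[ h ] Div (+ n ℤ.* h ℤ.- + 1)
    unsigned n (Bézout.+- x y eq) = ℤ.- + y , divides (ℤ.- + x) (begin
      + n ℤ.* ℤ.- + y ℤ.- + 1          ≡⟨ identity (+ n) (+ y) ⟩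
      ℤ.- (+ 1 ℤ.+ + y ℤ.* + n)        ≡⟨ cong (λ t → ℤ.- (+ 1 ℤ.+ t)) (sym (ℤₚ.pos-* y n)) ⟩
      ℤ.- + (1 ℕ.+ y ℕ.* n)            ≡⟨ cong (λ t → ℤ.- + t) eq ⟩
      ℤ.- + (x ℕ.* p)                  ≡⟨ cong ℤ.-_ (ℤₚ.pos-* x p) ⟩
      ℤ.- (+ x ℤ.* + p)                ≡⟨ ℤₚ.neg-distribˡ-* (+ x) (+ p) ⟩
      ℤ.- + x ℤ.* + p                  ∎)
      where
      open ≡-Reasoning
      identity : ∀ n y → n ℤ.* ℤ.- y ℤ.- + 1 ≡ ℤ.- (+ 1 ℤ.+ y ℤ.* n)
      identity = ℤ-Solver.solve-∀
    unsigned n (Bézout.-+ x y eq) = + y , divides (+ x) (begin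
      + n ℤ.* + y ℤ.- + 1              ≡⟨ cong (ℤ._- + 1) (ℤₚ.*-comm (+ n) (+ y)) ⟩
      + y ℤ.* + n ℤ.- + 1              ≡⟨ cong (ℤ._- + 1) (ℤₚ.pos-* y n) ⟨
      + (y ℕ.* n) ℤ.- + 1              ≡⟨ cong (λ t → + t ℤ.- + 1) eq ⟨
      + 1 ℤ.+ + (x ℕ.* p) ℤ.- + 1      ≡⟨ identity (+ (x ℕ.* p)) ⟩
      + (x ℕ.* p)                      ≡⟨ ℤₚ.pos-* x p ⟩
      + x ℤ.* + p                      ∎)
      where
      open ≡-Reasoning
      identity : ∀ t → + 1 ℤ.+ t ℤ.- + 1 ≡ t
      identity = ℤ-Solver.solve-∀
    signed : ∀ m → Bézout.Identity 1 p ∣ m ∣ → ∃[ h ] Div (m ℤ.* h ℤ.- + 1)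
    signed (+ n) b = unsigned n b
    signed -[1+ n ] b with unsigned (suc n) b
    ... | h , d = ℤ.- h , subst Div (identity (+ suc n) h) d
      where
      identity : ∀ m h → m ℤ.* h ℤ.- + 1 ≡ ℤ.- m ℤ.* ℤ.- h ℤ.- + 1
      identity = ℤ-Solver.solve-∀

  ¬Div-inverse : ∀ {m h} → Div (m ℤ.* h ℤ.- + 1) → ¬ Div h
  ¬Div-inverse {m} {h} d dh = ¬Div-1 (Div-comb m (ℤ.- + 1) dh d (identity (m ℤ.* h)))
    where
    identity : ∀ t → + 1 ≡ t ℤ.+ (ℤ.- + 1) ℤ.* (t ℤ.- + 1)
    identity = ℤ-Solver.solve-∀

  NonZeroPair : ℤ → ℤ → Set
  NonZeroPair a b = ¬ (Div a × Div b)

  coprime⇒nonZeroPair : ∀ {a b} → Coprime a b → NonZeroPair a b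
  coprime⇒nonZeroPair cop (da , db) = ¬Div-1 (subst (λ t → Div (+ t)) (cop (∣⇒∣ᵤ da , ∣⇒∣ᵤ db)) Signed.∣-refl)

  -- Some coordinate of b is invertible modulo p, and the factor is the quotient of the coordinates
  -- there, a₁/b₁ or a₀/b₀. It is a unit, since otherwise both coordinates of a would vanish.
  proportional : ∀ {a₁ a₀ b₁ b₀} → NonZeroPair a₁ a₀ → NonZeroPair b₁ b₀ →
    Div (a₁ ℤ.* b₀ ℤ.- a₀ ℤ.* b₁) →
    ∃[ l ] (¬ Div l × Div (a₁ ℤ.- l ℤ.* b₁) × Div (a₀ ℤ.- l ℤ.* b₀))
  proportional {a₁} {a₀} {b₁} {b₀} a≢0 b≢0 cross with Div? b₁
  ... | no ¬b₁ with inverse-mod ¬b₁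
  ...   | h , d = a₁ ℤ.* h , unit , d₁ , d₀
    where
    id₁ : ∀ a₁ b₁ h → a₁ ℤ.- a₁ ℤ.* h ℤ.* b₁ ≡ (ℤ.- a₁) ℤ.* (b₁ ℤ.* h ℤ.- + 1)
    id₁ = ℤ-Solver.solve-∀
    id₀ : ∀ a₁ a₀ b₁ b₀ h → a₀ ℤ.- a₁ ℤ.* h ℤ.* b₀ ≡
          (ℤ.- h) ℤ.* (a₁ ℤ.* b₀ ℤ.- a₀ ℤ.* b₁) ℤ.+ (ℤ.- a₀) ℤ.* (b₁ ℤ.* h ℤ.- + 1)
    id₀ = ℤ-Solver.solve-∀
    d₁ = subst Div (sym (id₁ a₁ b₁ h)) (Div-*ˡ (ℤ.- a₁) d)
    d₀ = Div-comb (ℤ.- h) (ℤ.- a₀) cross d (id₀ a₁ a₀ b₁ b₀ h)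
    id' : ∀ a l b → a ≡ + 1 ℤ.* (a ℤ.- l ℤ.* b) ℤ.+ b ℤ.* l
    id' = ℤ-Solver.solve-∀
    unit : ¬ Div (a₁ ℤ.* h)
    unit dl = a≢0 (Div-comb (+ 1) b₁ d₁ dl (id' a₁ _ b₁) , Div-comb (+ 1) b₀ d₀ dl (id' a₀ _ b₀))
  proportional {a₁} {a₀} {b₁} {b₀} a≢0 b≢0 cross | yes db₁ with inverse-mod (λ db₀ → b≢0 (db₁ , db₀))
  ...   | h , d = a₀ ℤ.* h , unit , d₁ , d₀
    where
    id₀ : ∀ a₁ b₁ h → a₁ ℤ.- a₁ ℤ.* h ℤ.* b₁ ≡ (ℤ.- a₁) ℤ.* (b₁ ℤ.* h ℤ.- + 1)
    id₀ = ℤ-Solver.solve-∀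
    id₁ : ∀ a₁ a₀ b₁ b₀ h → a₁ ℤ.- a₀ ℤ.* h ℤ.* b₁ ≡
          h ℤ.* (a₁ ℤ.* b₀ ℤ.- a₀ ℤ.* b₁) ℤ.+ (ℤ.- a₁) ℤ.* (b₀ ℤ.* h ℤ.- + 1)
    id₁ = ℤ-Solver.solve-∀
    d₀ = subst Div (sym (id₀ a₀ b₀ h)) (Div-*ˡ (ℤ.- a₀) d)
    d₁ = Div-comb h (ℤ.- a₁) cross d (id₁ a₁ a₀ b₁ b₀ h)
    id' : ∀ a l b → a ≡ + 1 ℤ.* (a ℤ.- l ℤ.* b) ℤ.+ b ℤ.* l
    id' = ℤ-Solver.solve-∀
    unit : ¬ Div (a₀ ℤ.* h)
    unit dl = a≢0 (Div-comb (+ 1) b₁ d₁ dl (id' a₁ _ b₁) , Div-comb (+ 1) b₀ d₀ dl (id' a₀ _ b₀))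

  -- The ring ℤ₍ₚ₎ and its maximal ideal

  -- J is the ideal pℤ₍ₚ₎ and O the ring ℤ₍ₚ₎, as subsets of ℚ.
  J O : ℚ → Set
  J q = ∃[ m ] ∃[ k ] (¬ Div m × Div k × ι m * q ≡ ι k)
  O q = ∃[ m ] ∃[ k ] (¬ Div m × ι m * q ≡ ι k)

  J-ι : ∀ {k} → Div k → J (ι k)
  J-ι {k} d = + 1 , k , ¬Div-1 , d , ℚₚ.*-identityˡ (ι k)

  J-ι⁻¹ : ∀ {k} → J (ι k) → Div k
  J-ι⁻¹ {k} (m , l , ¬m , dl , eq) =
    Div-cancelˡ ¬m (subst Div (sym (ι-injective (trans (ι-* m k) eq))) dl)

  J-0 : J 0ℚ
  J-0 = J-ι Div-0

  O-ι : ∀ k → O (ι k)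
  O-ι k = + 1 , k , ¬Div-1 , ℚₚ.*-identityˡ (ι k)

  J⇒O : ∀ {q} → J q → O q
  J⇒O (m , k , ¬m , _ , eq) = m , k , ¬m , eq

  private
    sum-eq : ∀ {a b} m k m' k' → ι m * a ≡ ι k → ι m' * b ≡ ι k' →
      ι (m ℤ.* m') * (a + b) ≡ ι (m' ℤ.* k ℤ.+ m ℤ.* k')
    sum-eq {a} {b} m k m' k' eq eq' = begin
      ι (m ℤ.* m') * (a + b)                    ≡⟨ cong (_* (a + b)) (ι-* m m') ⟩
      ι m * ι m' * (a + b)                      ≡⟨ identity (ι m) (ι m') a b ⟩
      ι m' * (ι m * a) + ι m * (ι m' * b)       ≡⟨ cong₂ (λ s t → ι m' * s + ι m * t) eq eq' ⟩
      ι m' * ι k + ι m * ι k'                   ≡⟨ cong₂ _+_ (ι-* m' k) (ι-* m k') ⟨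
      ι (m' ℤ.* k) + ι (m ℤ.* k')               ≡⟨ ι-+ (m' ℤ.* k) (m ℤ.* k') ⟨
      ι (m' ℤ.* k ℤ.+ m ℤ.* k')                 ∎
      where
      open ≡-Reasoning
      identity : ∀ m m' a b → m * m' * (a + b) ≡ m' * (m * a) + m * (m' * b)
      identity = solve-∀ ℚ-ring

    prod-eq : ∀ {a b} m k m' k' → ι m * a ≡ ι k → ι m' * b ≡ ι k' →
      ι (m ℤ.* m') * (a * b) ≡ ι (k ℤ.* k')
    prod-eq {a} {b} m k m' k' eq eq' = begin
      ι (m ℤ.* m') * (a * b)                    ≡⟨ cong (_* (a * b)) (ι-* m m') ⟩
      ι m * ι m' * (a * b)                      ≡⟨ identity (ι m) (ι m') a b ⟩
      (ι m * a) * (ι m' * b)                    ≡⟨ cong₂ _*_ eq eq' ⟩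
      ι k * ι k'                                ≡⟨ ι-* k k' ⟨
      ι (k ℤ.* k')                              ∎
      where
      open ≡-Reasoning
      identity : ∀ m m' a b → m * m' * (a * b) ≡ (m * a) * (m' * b)
      identity = solve-∀ ℚ-ring

  J-+ : ∀ {a b} → J a → J b → J (a + b)
  J-+ (m , k , ¬m , dk , eq) (m' , k' , ¬m' , dk' , eq') =
    m ℤ.* m' , m' ℤ.* k ℤ.+ m ℤ.* k' , ¬Div-* ¬m ¬m' , Div-+ (Div-*ˡ m' dk) (Div-*ˡ m dk') ,
    sum-eq m k m' k' eq eq'

  O-+ : ∀ {a b} → O a → O b → O (a + b)
  O-+ (m , k , ¬m , eq) (m' , k' , ¬m' , eq') =
    m ℤ.* m' , m' ℤ.* k ℤ.+ m ℤ.* k' , ¬Div-* ¬m ¬m' , sum-eq m k m' k' eq eq'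

  J-* : ∀ {a b} → O a → J b → J (a * b)
  J-* (m , k , ¬m , eq) (m' , k' , ¬m' , dk' , eq') =
    m ℤ.* m' , k ℤ.* k' , ¬Div-* ¬m ¬m' , Div-*ˡ k dk' , prod-eq m k m' k' eq eq'

  O-* : ∀ {a b} → O a → O b → O (a * b)
  O-* (m , k , ¬m , eq) (m' , k' , ¬m' , eq') =
    m ℤ.* m' , k ℤ.* k' , ¬Div-* ¬m ¬m' , prod-eq m k m' k' eq eq'

  J-comb : ∀ {z x y a b} → O a → O b → J x → J y → z ≡ a * x + b * y → J z
  J-comb oa ob jx jy refl = J-+ (J-* oa jx) (J-* ob jy)

  -- The cofactor a need not be p-integral here.
  J-cancel : ∀ {a b} → O b → ¬ J b → J (b * a) → J a
  J-cancel {a} {b} (m , k , ¬m , eq) ¬Jb (m' , k' , ¬m' , dk' , eq') =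
    m' ℤ.* k , m ℤ.* k' , ¬Div-* ¬m' (λ dk → ¬Jb (m , k , ¬m , dk , eq)) , Div-*ˡ m dk' , (begin
      ι (m' ℤ.* k) * a           ≡⟨ cong (_* a) (ι-* m' k) ⟩
      ι m' * ι k * a             ≡⟨ cong (λ t → ι m' * t * a) eq ⟨
      ι m' * (ι m * b) * a       ≡⟨ identity (ι m') (ι m) b a ⟩
      ι m * (ι m' * (b * a))     ≡⟨ cong (ι m *_) eq' ⟩
      ι m * ι k'                 ≡⟨ ι-* m k' ⟨
      ι (m ℤ.* k')               ∎)
    where
    open ≡-Reasoning
    identity : ∀ m' m b a → m' * (m * b) * a ≡ m * (m' * (b * a))
    identity = solve-∀ ℚ-ring

  -- Membership in the ideal does not depend on the fraction chosen, so it can be tested on the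
  -- numerator k of the given one.
  J? : ∀ {q} → O q → Dec (J q)
  J? {q} (m , k , ¬m , eq) with Div? k
  ... | yes dk = yes (m , k , ¬m , dk , eq)
  ... | no ¬dk = no λ j → ¬dk (J-ι⁻¹ (subst J eq (J-* (O-ι m) j)))

  -- In lowest terms a numerator divisible by p forces a denominator prime to p, so the two serve as
  -- witnesses themselves.
  numerator⇒J : ∀ q → + p ∣ (↥ q) → J q
  numerator⇒J q@(mkℚ n d-1 cop) dn = ↧ q , ↥ q , ¬d , ∣ᵤ⇒∣ dn , ι-↧↥ q
    where
    ¬d : ¬ Div (↧ q)
    ¬d d = ¬Div-1 (subst (λ t → Div (+ t)) (ℕC.recompute cop (dn , ∣⇒∣ᵤ d)) Signed.∣-refl)

  J⇒numerator : ∀ q → J q → + p ∣ (↥ q)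
  J⇒numerator q j = ∣⇒∣ᵤ {i = ↥ q} (J-ι⁻¹ (subst J (ι-↧↥ q) (J-* (O-ι (↧ q)) j)))

-- Two-sided induction, elimination and coprime representatives

ℤ-spread : (T : ℤ → Set) → (∀ n → T n → T (n ℤ.+ + 1)) → (∀ n → T (n ℤ.+ + 1) → T n) →
  ∀ {a} → T a → ∀ n → T n
ℤ-spread T up down {a} ta n = subst T (back n a) (both (n ℤ.- a))
  where
  back : ∀ n a → a ℤ.+ (n ℤ.- a) ≡ n
  back = ℤ-Solver.solve-∀
  id₀ : ∀ a → a ≡ a ℤ.+ + 0
  id₀ = ℤ-Solver.solve-∀
  id₁ : ∀ a t → a ℤ.+ t ℤ.+ + 1 ≡ a ℤ.+ (+ 1 ℤ.+ t)
  id₁ = ℤ-Solver.solve-∀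
  id₂ : ∀ a t → a ℤ.- t ≡ a ℤ.- (+ 1 ℤ.+ t) ℤ.+ + 1
  id₂ = ℤ-Solver.solve-∀
  right : ∀ k → T (a ℤ.+ + k)
  right zero = subst T (id₀ a) ta
  right (suc k) = subst T (id₁ a (+ k)) (up _ (right k))
  left : ∀ k → T (a ℤ.- + k)
  left zero = subst T (id₀ a) ta
  left (suc k) = down _ (subst T (id₂ a (+ k)) (left k))
  both : ∀ m → T (a ℤ.+ m)
  both (+ k) = right k
  both -[1+ k ] = left (suc k)

-- Reduction modulo a relation r = 0: a polynomial identity is proved outright, and k is the
-- cofactor of r in it.
elim0 : ∀ {x y r} k → r ≡ 0ℚ → x ≡ y + k * r → x ≡ y
elim0 {x} {y} {r} k r0 eq = begin
  x           ≡⟨ eq ⟩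
  y + k * r   ≡⟨ cong (λ t → y + k * t) r0 ⟩
  y + k * 0ℚ  ≡⟨ cong (_+_ y) (ℚₚ.*-zeroʳ k) ⟩
  y + 0ℚ      ≡⟨ ℚₚ.+-identityʳ y ⟩
  y           ∎
  where open ≡-Reasoning

n+1+1≡n+2 : ∀ n → n ℤ.+ + 1 ℤ.+ + 1 ≡ n ℤ.+ + 2
n+1+1≡n+2 = ℤ-Solver.solve-∀

-- The point [q₁ : q₀] is [1 : 0] or [t : 1] with t = q₁/q₀; in the second case the numerator and
-- denominator of t in lowest terms are the coordinates.
coprime-multiple : ∀ q₁ q₀ → ¬ (q₁ ≡ 0ℚ × q₀ ≡ 0ℚ) →
  ∃[ c₁ ] ∃[ c₀ ] ∃[ κ ] ((κ ≢ 0ℚ × κ * q₁ ≡ ι c₁ × κ * q₀ ≡ ι c₀) × Coprime c₁ c₀)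
coprime-multiple q₁ q₀ nz with q₀ ℚₚ.≟ 0ℚ
... | yes refl with inverse {q₁} (λ q₁≡0 → nz (q₁≡0 , refl))
...   | i , iq = + 1 , + 0 , i , (*≡1⇒≢0 {i} {q₁} iq , iq , ℚₚ.*-zeroʳ i) , λ (d∣1 , _) → ℕ∣.∣1⇒≡1 d∣1
coprime-multiple q₁ q₀ nz | no q₀≢0 with inverse q₀≢0
... | i , iq = ↥ t , ↧ t , ι (↧ t) * i , (*-≢0 {ι (↧ t)} {i} (ι≢0 {↧ t} (λ ())) (*≡1⇒≢0 {i} {q₀} iq) , eq₁ , eq₀) , coprime t
  where
  t = i * q₁
  eq₁ : ι (↧ t) * i * q₁ ≡ ι (↥ t)
  eq₁ = trans (ℚₚ.*-assoc (ι (↧ t)) i q₁) (ι-↧↥ t)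
  eq₀ : ι (↧ t) * i * q₀ ≡ ι (↧ t)
  eq₀ = trans (ℚₚ.*-assoc (ι (↧ t)) i q₀) (trans (cong (ι (↧ t) *_) iq) (ℚₚ.*-identityʳ _))
  coprime : ∀ t → Coprime (↥ t) (↧ t)
  coprime (mkℚ _ _ c) = ℕC.recompute c

-- Rational sequences satisfying the recurrence

module Sequences (P Q : ℤ) (Q≢0 : Q ≢ + 0) where

  Seq : Set
  Seq = ℤ → ℚ

  rec : Seq → ℤ → ℚ
  rec d n = (d (n ℤ.+ + 2) - ι P * d (n ℤ.+ + 1)) + ι Q * d n

  rec-shift : ∀ d n → rec d (n ℤ.+ + 1) ≡ (d (n ℤ.+ + 2 ℤ.+ + 1) - ι P * d (n ℤ.+ + 2)) + ι Q * d (n ℤ.+ + 1)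
  rec-shift d n = cong₂ (λ s t → (d s - ι P * d t) + ι Q * d (n ℤ.+ + 1)) (swap n) (n+1+1≡n+2 n)
    where
    swap : ∀ n → n ℤ.+ + 1 ℤ.+ + 2 ≡ n ℤ.+ + 2 ℤ.+ + 1
    swap = ℤ-Solver.solve-∀

  step : ∀ w → IsSeq P Q w → ∀ n → w (n ℤ.+ + 2) ≡ ι P * w (n ℤ.+ + 1) - ι Q * w n
  step w isSeq n = elim0 1ℚ (isSeq n) (identity (ι P) (ι Q) (w (n ℤ.+ + 2)) (w (n ℤ.+ + 1)) (w n))
    where
    identity : ∀ P Q c b a → c ≡ (P * b - Q * a) + 1ℚ * ((c - P * b) + Q * a)
    identity = solve-∀ ℚ-ring

  -- Since Q is invertible on S, a sequence satisfying the recurrence modulo S is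
  -- determined modulo S by any two consecutive terms.
  record Stable (S : ℚ → Set) : Set where
    field
      zeroˢ  : S 0ℚ
      add    : ∀ {a b} → S a → S b → S (a + b)
      scale  : ∀ k {a} → S a → S (ι k * a)
      cancel : ∀ {a} → S (ι Q * a) → S a

    neg : ∀ {x} → S x → S (- x)
    neg {x} sx = subst S (identity x) (scale (ℤ.- + 1) sx)
      where
      identity : ∀ x → - 1ℚ * x ≡ - x
      identity = solve-∀ ℚ-ring

    spread : ∀ d → (∀ n → S (rec d n)) → ∀ a → S (d (a ℤ.+ + 1)) → S (d a) → ∀ n → S (d n)
    spread d r a s₁ s₀ n = proj₂ (ℤ-spread T up down {a} (s₁ , s₀) n)
      where
      T : ℤ → Set
      T n = S (d (n ℤ.+ + 1)) × S (d n)
      up : ∀ n → T n → T (n ℤ.+ + 1)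
      up n (s₁ , s₀) = subst (S ∘ d) (sym (n+1+1≡n+2 n)) (subst S
        (identity (ι P) (ι Q) (d (n ℤ.+ + 2)) (d (n ℤ.+ + 1)) (d n))
        (add (r n) (add (scale P s₁) (neg (scale Q s₀))))) , s₁
        where
        identity : ∀ P Q c b a → ((c - P * b) + Q * a) + (P * b + - (Q * a)) ≡ c
        identity = solve-∀ ℚ-ring
      down : ∀ n → T (n ℤ.+ + 1) → T n
      down n (s₂ , s₁) = s₁ , cancel (subst S
        (identity (ι P) (ι Q) (d (n ℤ.+ + 2)) (d (n ℤ.+ + 1)) (d n))
        (add (r n) (add (scale P s₁) (neg (subst (S ∘ d) (n+1+1≡n+2 n) s₂)))))
        where
        identity : ∀ P Q c b a → ((c - P * b) + Q * a) + (P * b + - c) ≡ Q * a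
        identity = solve-∀ ℚ-ring

    -- One step along the sequence multiplies Λ by Q, which `scale` allows upwards and `cancel`
    -- undoes downwards.
    Λ-spread : ∀ w → IsSeq P Q w → ∀ a → S (Λ P Q (w (a ℤ.+ + 1)) (w a)) →
      ∀ n → S (Λ P Q (w (n ℤ.+ + 1)) (w n))
    Λ-spread w isSeq a sa n = ℤ-spread T (λ n t → subst S (sym (Λ-step n)) (scale Q t))
      (λ n t → cancel (subst S (Λ-step n) t)) {a} sa n
      where
      T : ℤ → Set
      T n = S (Λ P Q (w (n ℤ.+ + 1)) (w n))
      identity : ∀ P Q b a → let c = P * b - Q * a in
        (c * c - P * b * c) + Q * b * b ≡ Q * ((b * b - P * a * b) + Q * a * a)
      identity = solve-∀ ℚ-ring
      Λ-step : ∀ n → Λ P Q (w (n ℤ.+ + 1 ℤ.+ + 1)) (w (n ℤ.+ + 1)) ≡ ι Q * Λ P Q (w (n ℤ.+ + 1)) (w n)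
      Λ-step n = trans
        (cong (λ t → Λ P Q t (w (n ℤ.+ + 1))) (trans (cong w (n+1+1≡n+2 n)) (step w isSeq n)))
        (identity (ι P) (ι Q) (w (n ℤ.+ + 1)) (w n))

  zero-stable : Stable (_≡ 0ℚ)
  zero-stable = record
    { zeroˢ = refl
    ; add = λ { refl refl → refl }
    ; scale = λ { k refl → ℚₚ.*-zeroʳ (ι k) }
    ; cancel = λ eq → *-cancelˡ (ι≢0 Q≢0) (trans eq (sym (ℚₚ.*-zeroʳ (ι Q))))
    }

  scale-isSeq : ∀ k w → IsSeq P Q w → IsSeq P Q (λ n → k * w n)
  scale-isSeq k w s n = elim0 k (s n) (identity (ι P) (ι Q) k (w (n ℤ.+ + 2)) (w (n ℤ.+ + 1)) (w n))
    where
    identity : ∀ P Q k c b a → (k * c - P * (k * b)) + Q * (k * a) ≡ 0ℚ + k * ((c - P * b) + Q * a)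
    identity = solve-∀ ℚ-ring

  rec-sub : ∀ u v n → rec (λ m → u m - v m) n ≡ rec u n - rec v n
  rec-sub u v n = identity (ι P) (ι Q) (u (n ℤ.+ + 2)) (u (n ℤ.+ + 1)) (u n) (v (n ℤ.+ + 2)) (v (n ℤ.+ + 1)) (v n)
    where
    identity : ∀ P Q c b a c' b' a' → ((c - c') - P * (b - b')) + Q * (a - a') ≡
      ((c - P * b) + Q * a) - ((c' - P * b') + Q * a')
    identity = solve-∀ ℚ-ring

  sub≡0⇒≡ : ∀ {a b} → a - b ≡ 0ℚ → a ≡ b
  sub≡0⇒≡ {a} {b} eq = elim0 1ℚ eq (identity a b)
    where
    identity : ∀ a b → a ≡ b + 1ℚ * (a - b)
    identity = solve-∀ ℚ-ring

  ≡⇒sub≡0 : ∀ {a b} → a ≡ b → a - b ≡ 0ℚ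
  ≡⇒sub≡0 {a} refl = ℚₚ.+-inverseʳ a

  isSeq-unique : ∀ u v → IsSeq P Q u → IsSeq P Q v → init P Q u ≡ init P Q v → ∀ n → u n ≡ v n
  isSeq-unique u v su sv eq n = sub≡0⇒≡ (Stable.spread zero-stable (λ m → u m - v m)
    (λ m → trans (rec-sub u v m) (cong₂ _-_ (su m) (sv m))) (+ 0)
    (≡⇒sub≡0 (cong proj₁ eq)) (≡⇒sub≡0 (cong proj₂ eq)) n)

  shift : ℤ → Seq → Seq
  shift ν w n = w (n ℤ.+ ν)

  shift-isSeq : ∀ ν w → IsSeq P Q w → IsSeq P Q (shift ν w)
  shift-isSeq ν w s n = subst₂ (λ a b → (w a - ι P * w b) + ι Q * w (n ℤ.+ ν) ≡ 0ℚ)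
    (swap n (+ 2) ν) (swap n (+ 1) ν) (s (n ℤ.+ ν))
    where
    swap : ∀ n k ν → n ℤ.+ ν ℤ.+ k ≡ n ℤ.+ k ℤ.+ ν
    swap = ℤ-Solver.solve-∀

  at-shift : ∀ (w : Seq) ν → w (+ 1 ℤ.+ ν) ≡ w (ν ℤ.+ + 1)
  at-shift w ν = cong w (ℤₚ.+-comm (+ 1) ν)

  at-shift₀ : ∀ (w : Seq) ν → w (+ 0 ℤ.+ ν) ≡ w ν
  at-shift₀ w ν = cong w (ℤₚ.+-identityˡ ν)

  shift-elem : ∀ ν w → Elem P Q w → Elem P Q (shift ν w)
  shift-elem ν w (s , Λ≢0) = shift-isSeq ν w s , λ Λ≡0 → Λ≢0
    (Stable.Λ-spread zero-stable w s ν (subst₂ (λ a b → Λ P Q a b ≡ 0ℚ) (at-shift w ν) (at-shift₀ w ν) Λ≡0) (+ 0))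

  -- Λ is the norm of w₁ + w₀ t in ℚ[t]/(t² + P t + Q), and `mulInit` is the product there.
  Λ-* : ∀ a₁ a₀ b₁ b₀ → let (c₁ , c₀) = mulInit P Q (a₁ , a₀) (b₁ , b₀) in
    Λ P Q c₁ c₀ ≡ Λ P Q a₁ a₀ * Λ P Q b₁ b₀
  Λ-* = identity (ι P) (ι Q)
    where
    identity : ∀ P Q a₁ a₀ b₁ b₀ →
      let c₁ = a₁ * b₁ - Q * a₀ * b₀
          c₀ = (a₀ * b₁ + a₁ * b₀) - P * a₀ * b₀ in
      (c₁ * c₁ - P * c₀ * c₁) + Q * c₀ * c₀ ≡
      ((a₁ * a₁ - P * a₀ * a₁) + Q * a₀ * a₀) * ((b₁ * b₁ - P * b₀ * b₁) + Q * b₀ * b₀)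
    identity = solve-∀ ℚ-ring

  Λ-scale : ∀ k a₁ a₀ → Λ P Q (k * a₁) (k * a₀) ≡ k * k * Λ P Q a₁ a₀
  Λ-scale = identity (ι P) (ι Q)
    where
    identity : ∀ P Q k a₁ a₀ → (k * a₁ * (k * a₁) - P * (k * a₀) * (k * a₁)) + Q * (k * a₀) * (k * a₀) ≡
      k * k * ((a₁ * a₁ - P * a₀ * a₁) + Q * a₀ * a₀)
    identity = solve-∀ ℚ-ring

  ι-Λ : ∀ a₁ a₀ → ι (Λℤ P Q a₁ a₀) ≡ Λ P Q (ι a₁) (ι a₀)
  ι-Λ a₁ a₀ = trans (ι-+ (a₁ ℤ.* a₁ ℤ.- P ℤ.* a₀ ℤ.* a₁) (Q ℤ.* a₀ ℤ.* a₀)) (cong₂ _+_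
    (trans (ι-sub (a₁ ℤ.* a₁) (P ℤ.* a₀ ℤ.* a₁)) (cong₂ _-_ (ι-* a₁ a₁) (ι-*³ P a₀ a₁))) (ι-*³ Q a₀ a₀))

  scale-elem : ∀ k w → k ≢ 0ℚ → Elem P Q w → Elem P Q (λ n → k * w n)
  scale-elem k w k≢0 (s , Λ≢0) = scale-isSeq k w s ,
    λ eq → *-≢0 (*-≢0 k≢0 k≢0) Λ≢0 (trans (sym (Λ-scale k (w (+ 1)) (w (+ 0)))) eq)

  simStar-refl : ∀ w → SimStar P Q w w
  simStar-refl w = 1ℚ , (λ ()) , + 0 , λ n → sym (trans (ℚₚ.*-identityˡ _) (cong w (ℤₚ.+-identityʳ n)))

  scale-simStar : ∀ k w → k ≢ 0ℚ → SimStar P Q (λ n → k * w n) w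
  scale-simStar k w k≢0 = k , k≢0 , + 0 , λ n → cong (λ m → k * w m) (sym (ℤₚ.+-identityʳ n))

  shift-simStar : ∀ ν w → SimStar P Q (shift ν w) w
  shift-simStar ν w = 1ℚ , (λ ()) , ν , λ n → sym (ℚₚ.*-identityˡ _)

  simStar-trans : ∀ u v w → SimStar P Q u v → SimStar P Q v w → SimStar P Q u w
  simStar-trans u v w (k , k≢0 , ν , e) (l , l≢0 , μ , f) = k * l , *-≢0 k≢0 l≢0 , ν ℤ.+ μ , λ n → begin
    u n                           ≡⟨ e n ⟩
    k * v (n ℤ.+ ν)               ≡⟨ cong (k *_) (f (n ℤ.+ ν)) ⟩
    k * (l * w (n ℤ.+ ν ℤ.+ μ))   ≡⟨ ℚₚ.*-assoc k l _ ⟨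
    k * l * w (n ℤ.+ ν ℤ.+ μ)     ≡⟨ cong (λ m → k * l * w m) (ℤₚ.+-assoc n ν μ) ⟩
    k * l * w (n ℤ.+ (ν ℤ.+ μ))   ∎
    where open ≡-Reasoning

  -- Products and powers of sequences

  -- Multiplication by the class of t with t² = − P t − Q, under which
  -- (w₁ , w₀) stands for w₁ + w₀ t, sends w to the sequence w_{n+1} − P w_n.
  prodSeq : Seq → Seq → Seq
  prodSeq a b n = b (+ 1) * a n + b (+ 0) * (a (n ℤ.+ + 1) - ι P * a n)

  prodSeq-isSeq : ∀ a b → IsSeq P Q a → IsSeq P Q (prodSeq a b)
  prodSeq-isSeq a b s n =
    -- The recurrence for the product at n is b₁ - P b₀ times that of a at n, plus b₀ times that of
    -- a at n + 1.
    elim0 (b₁ - ι P * b₀) (s n) (elim0 b₀ (trans (sym (rec-shift a n)) (s (n ℤ.+ + 1)))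
      (trans (cong (λ t → (b₁ * a (n ℤ.+ + 2) + b₀ * (a (n ℤ.+ + 2 ℤ.+ + 1) - ι P * a (n ℤ.+ + 2))
                 - ι P * (b₁ * a (n ℤ.+ + 1) + b₀ * (t - ι P * a (n ℤ.+ + 1)))) +
                 ι Q * (b₁ * a n + b₀ * (a (n ℤ.+ + 1) - ι P * a n))) (cong a (n+1+1≡n+2 n)))
        (identity (ι P) (ι Q) b₁ b₀ (a (n ℤ.+ + 2 ℤ.+ + 1)) (a (n ℤ.+ + 2)) (a (n ℤ.+ + 1)) (a n))))
    where
    b₁ = b (+ 1)
    b₀ = b (+ 0)
    identity : ∀ P Q b₁ b₀ a₃ a₂ a₁ a₀ →
      (b₁ * a₂ + b₀ * (a₃ - P * a₂) - P * (b₁ * a₁ + b₀ * (a₂ - P * a₁))) + Q * (b₁ * a₀ + b₀ * (a₁ - P * a₀))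
      ≡ (0ℚ + (b₁ - P * b₀) * ((a₂ - P * a₁) + Q * a₀)) + b₀ * ((a₃ - P * a₂) + Q * a₁)
    identity = solve-∀ ℚ-ring

  prodSeq-prod : ∀ a b → IsSeq P Q a → Prod P Q a b (prodSeq a b)
  prodSeq-prod a b s = cong₂ _,_
    (trans (cong (λ t → b (+ 1) * a (+ 1) + b (+ 0) * (t - ι P * a (+ 1))) (step a s (+ 0)))
      (id₁ (ι P) (ι Q) (b (+ 1)) (b (+ 0)) (a (+ 1)) (a (+ 0))))
    (id₀ (ι P) (b (+ 1)) (b (+ 0)) (a (+ 1)) (a (+ 0)))
    where
    id₁ : ∀ P Q b₁ b₀ a₁ a₀ → b₁ * a₁ + b₀ * (P * a₁ - Q * a₀ - P * a₁) ≡ a₁ * b₁ - Q * a₀ * b₀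
    id₁ = solve-∀ ℚ-ring
    id₀ : ∀ P b₁ b₀ a₁ a₀ → b₁ * a₀ + b₀ * (a₁ - P * a₀) ≡ (a₀ * b₁ + a₁ * b₀) - P * a₀ * b₀
    id₀ = solve-∀ ℚ-ring

  prod-unique : ∀ a b u → IsSeq P Q a → IsSeq P Q u → Prod P Q a b u → ∀ n → u n ≡ prodSeq a b n
  prod-unique a b u sa su pr =
    isSeq-unique u (prodSeq a b) su (prodSeq-isSeq a b sa) (trans pr (sym (prodSeq-prod a b sa)))

  mulInit-comm : ∀ a b → mulInit P Q a b ≡ mulInit P Q b a
  mulInit-comm (a₁ , a₀) (b₁ , b₀) = cong₂ _,_ (id₁ (ι Q) a₁ a₀ b₁ b₀) (id₀ (ι P) a₁ a₀ b₁ b₀)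
    where
    id₁ : ∀ Q a₁ a₀ b₁ b₀ → a₁ * b₁ - Q * a₀ * b₀ ≡ b₁ * a₁ - Q * b₀ * a₀
    id₁ = solve-∀ ℚ-ring
    id₀ : ∀ P a₁ a₀ b₁ b₀ → (a₀ * b₁ + a₁ * b₀) - P * a₀ * b₀ ≡ (b₀ * a₁ + b₁ * a₀) - P * b₀ * a₀
    id₀ = solve-∀ ℚ-ring

  mulInit-assoc : ∀ a b c → mulInit P Q (mulInit P Q a b) c ≡ mulInit P Q a (mulInit P Q b c)
  mulInit-assoc (a₁ , a₀) (b₁ , b₀) (c₁ , c₀) =
    cong₂ _,_ (id₁ (ι P) (ι Q) a₁ a₀ b₁ b₀ c₁ c₀) (id₀ (ι P) (ι Q) a₁ a₀ b₁ b₀ c₁ c₀)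
    where
    id₁ : ∀ P Q a₁ a₀ b₁ b₀ c₁ c₀ →
      (a₁ * b₁ - Q * a₀ * b₀) * c₁ - Q * ((a₀ * b₁ + a₁ * b₀) - P * a₀ * b₀) * c₀ ≡
      a₁ * (b₁ * c₁ - Q * b₀ * c₀) - Q * a₀ * ((b₀ * c₁ + b₁ * c₀) - P * b₀ * c₀)
    id₁ = solve-∀ ℚ-ring
    id₀ : ∀ P Q a₁ a₀ b₁ b₀ c₁ c₀ →
      (((a₀ * b₁ + a₁ * b₀) - P * a₀ * b₀) * c₁ + (a₁ * b₁ - Q * a₀ * b₀) * c₀)
        - P * ((a₀ * b₁ + a₁ * b₀) - P * a₀ * b₀) * c₀ ≡
      (a₀ * (b₁ * c₁ - Q * b₀ * c₀) + a₁ * ((b₀ * c₁ + b₁ * c₀) - P * b₀ * c₀))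
        - P * a₀ * ((b₀ * c₁ + b₁ * c₀) - P * b₀ * c₀)
    id₀ = solve-∀ ℚ-ring

  mulInit-identityʳ : ∀ a → mulInit P Q a (1ℚ , 0ℚ) ≡ a
  mulInit-identityʳ (a₁ , a₀) = cong₂ _,_ (id₁ (ι Q) a₁ a₀) (id₀ (ι P) a₁ a₀)
    where
    id₁ : ∀ Q a₁ a₀ → a₁ * 1ℚ - Q * a₀ * 0ℚ ≡ a₁
    id₁ = solve-∀ ℚ-ring
    id₀ : ∀ P a₁ a₀ → (a₀ * 1ℚ + a₁ * 0ℚ) - P * a₀ * 0ℚ ≡ a₀
    id₀ = solve-∀ ℚ-ring

  -- For fixed b, `prodSeq` is a combination of a and its shift with constant coefficients, so a
  -- scalar and a shift of a pass through it.
  simStar-prodSeqˡ : ∀ a a' b → SimStar P Q a a' → SimStar P Q (prodSeq a b) (prodSeq a' b)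
  simStar-prodSeqˡ a a' b (k , k≢0 , ν , e) = k , k≢0 , ν , λ n → trans
    (cong₂ (λ s t → b (+ 1) * s + b (+ 0) * (t - ι P * s)) (e n)
      (trans (e (n ℤ.+ + 1)) (cong (λ m → k * a' m) (swap n ν))))
    (identity (ι P) (b (+ 1)) (b (+ 0)) k (a' (n ℤ.+ ν ℤ.+ + 1)) (a' (n ℤ.+ ν)))
    where
    swap : ∀ n ν → n ℤ.+ + 1 ℤ.+ ν ≡ n ℤ.+ ν ℤ.+ + 1
    swap = ℤ-Solver.solve-∀
    identity : ∀ P b₁ b₀ k s t → b₁ * (k * t) + b₀ * (k * s - P * (k * t)) ≡ k * (b₁ * t + b₀ * (s - P * t))
    identity = solve-∀ ℚ-ring

  ≗⇒simStar : ∀ (u v : Seq) → (∀ n → u n ≡ v n) → SimStar P Q u v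
  ≗⇒simStar u v e = 1ℚ , (λ ()) , + 0 , λ n →
    trans (e n) (sym (trans (ℚₚ.*-identityˡ _) (cong v (ℤₚ.+-identityʳ n))))

  prodSeq-comm : ∀ a b → IsSeq P Q a → IsSeq P Q b → ∀ n → prodSeq a b n ≡ prodSeq b a n
  prodSeq-comm a b sa sb = prod-unique b a (prodSeq a b) sb (prodSeq-isSeq a b sa)
    (trans (prodSeq-prod a b sa) (mulInit-comm (init P Q a) (init P Q b)))

  -- `HL` takes powers of the given sequence, `InHStar` powers of some representative of its class;
  -- this moves a power from one to the other.
  powN-simStar : ∀ v w → IsSeq P Q v → IsSeq P Q w → SimStar P Q v w →
    ∀ k u → IsSeq P Q u → PowN P Q v k u → ∃[ u* ] (IsSeq P Q u* × PowN P Q w k u* × SimStar P Q u u*)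
  powN-simStar v w sv sw v∼w zero u su one = u , su , one , simStar-refl u
  powN-simStar v w sv sw v∼w (suc k) u su (u' , su' , pow , pr) with powN-simStar v w sv sw v∼w k u' su' pow
  ... | u* , su* , pow* , u'∼u* =
    prodSeq u* w , prodSeq-isSeq u* w su* , (u* , su* , pow* , prodSeq-prod u* w su*) ,
    -- The chain is u = u'v ∼* u*v = vu* ∼* wu* = u*w. Replacement is available in the left factor
    -- only, hence the two uses of commutativity.
    simStar-trans u (prodSeq u' v) (prodSeq u* w) (≗⇒simStar _ _ (prod-unique u' v u su' su pr))
    (simStar-trans (prodSeq u' v) (prodSeq u* v) (prodSeq u* w) (simStar-prodSeqˡ u' u* v u'∼u*)
    (simStar-trans (prodSeq u* v) (prodSeq v u*) (prodSeq u* w) (≗⇒simStar _ _ (prodSeq-comm u* v su* sv))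
    (simStar-trans (prodSeq v u*) (prodSeq w u*) (prodSeq u* w) (simStar-prodSeqˡ v w u* v∼w)
    (≗⇒simStar _ _ (prodSeq-comm w u* sw su*)))))

  powI : ℚ × ℚ → ℕ → ℚ × ℚ
  powI a zero = 1ℚ , 0ℚ
  powI a (suc k) = mulInit P Q (powI a k) a

  powN-init : ∀ w k u → PowN P Q w k u → init P Q u ≡ powI (init P Q w) k
  powN-init w zero u one = one
  powN-init w (suc k) u (u' , _ , pow , pr) = trans pr (cong (λ a → mulInit P Q a (init P Q w)) (powN-init w k u' pow))

  powI-+ : ∀ a k l → powI a (k ℕ.+ l) ≡ mulInit P Q (powI a l) (powI a k)
  powI-+ a zero l = sym (mulInit-identityʳ _)
  powI-+ a (suc k) l = trans (cong (λ t → mulInit P Q t a) (powI-+ a k l)) (mulInit-assoc (powI a l) (powI a k) a)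

  powI-* : ∀ a k l → powI a (l ℕ.* k) ≡ powI (powI a k) l
  powI-* a k zero = refl
  powI-* a k (suc l) = trans (powI-+ a k (l ℕ.* k)) (cong (λ t → mulInit P Q t (powI a k)) (powI-* a k l))

  -- Sequences with prescribed initial terms

  -- forward k = (w_{k+1} , w_k) and backward k = (w_{1-k} , w_{-k}).
  private
    module Extend (i a₁ a₀ : ℚ) where
      forward backward : ℕ → ℚ × ℚ
      forward zero = a₁ , a₀
      forward (suc k) = let (x₁ , x₀) = forward k in ι P * x₁ - ι Q * x₀ , x₁
      backward zero = a₁ , a₀
      backward (suc k) = let (x₁ , x₀) = backward k in x₀ , i * (ι P * x₀ - x₁)

      extend : Seq
      extend (+ k) = proj₂ (forward k)
      extend -[1+ k ] = proj₂ (backward (suc k))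

      recurrence : i * ι Q ≡ 1ℚ → IsSeq P Q extend
      recurrence iQ (+ k) rewrite ℕₚ.+-comm k 2 | ℕₚ.+-comm k 1 =
        identity (ι P) (ι Q) (proj₁ (forward k)) (proj₂ (forward k))
        where
        identity : ∀ P Q x₁ x₀ → (P * x₁ - Q * x₀ - P * x₁) + Q * x₀ ≡ 0ℚ
        identity = solve-∀ ℚ-ring
      recurrence iQ -[1+ k ] = at k
        where
        identity : ∀ P Q i x₁ x₀ → (x₁ - P * x₀) + Q * (i * (P * x₀ - x₁)) ≡ 0ℚ + (P * x₀ - x₁) * (i * Q - 1ℚ)
        identity = solve-∀ ℚ-ring
        eq : ∀ x₁ x₀ → (x₁ - ι P * x₀) + ι Q * (i * (ι P * x₀ - x₁)) ≡ 0ℚ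
        eq x₁ x₀ = elim0 (ι P * x₀ - x₁) (≡⇒sub≡0 iQ) (identity (ι P) (ι Q) i x₁ x₀)
        at : ∀ k → rec extend -[1+ k ] ≡ 0ℚ
        -- For n = -1 and n = -2 the three terms involved reach into the nonnegative indices; from n
        -- = -3 on all of them are backward terms.
        at zero = eq a₁ a₀
        at (suc zero) = eq a₀ (proj₂ (backward 1))
        at (suc (suc k)) = eq (proj₂ (backward (suc k))) (proj₂ (backward (suc (suc k))))

  seq-with-init : ∀ a₁ a₀ → ∃[ w ] (IsSeq P Q w × init P Q w ≡ (a₁ , a₀))
  seq-with-init a₁ a₀ with inverse (ι≢0 Q≢0)
  ... | i , iQ = Extend.extend i a₁ a₀ , Extend.recurrence i a₁ a₀ iQ , refl

  powN-exists : ∀ w k → ∃[ u ] (IsSeq P Q u × PowN P Q w k u)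
  powN-exists w zero = seq-with-init 1ℚ 0ℚ
  powN-exists w (suc k) with powN-exists w k
  ... | u , su , pow = prodSeq u w , prodSeq-isSeq u w su , u , su , pow , prodSeq-prod u w su

  prod-elem : ∀ a b u → Elem P Q a → Elem P Q b → IsSeq P Q u → Prod P Q a b u → Elem P Q u
  prod-elem a b u (_ , Λa) (_ , Λb) su pr = su , λ eq → *-≢0 Λa Λb
    (trans (sym (Λ-* (a (+ 1)) (a (+ 0)) (b (+ 1)) (b (+ 0)))) (trans (cong (λ (x , y) → Λ P Q x y) (sym pr)) eq))

  Λ-one : Λ P Q 1ℚ 0ℚ ≡ 1ℚ
  Λ-one = identity (ι P) (ι Q)
    where
    identity : ∀ P Q → (1ℚ * 1ℚ - P * 0ℚ * 1ℚ) + Q * 0ℚ * 0ℚ ≡ 1ℚ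
    identity = solve-∀ ℚ-ring

  powN-elem : ∀ w → Elem P Q w → ∀ k u → IsSeq P Q u → PowN P Q w k u → Elem P Q u
  powN-elem w ew zero u su one = su , λ eq → contradiction
    (trans (sym Λ-one) (trans (cong (λ (x , y) → Λ P Q x y) (sym one)) eq)) λ ()
  powN-elem w ew (suc k) u su (u' , su' , pow , pr) = prod-elem u' w u (powN-elem w ew k u' su' pow) ew su pr

  inverse-elem : ∀ a u → IsSeq P Q u → mulInit P Q (init P Q a) (init P Q u) ≡ (1ℚ , 0ℚ) → Elem P Q u
  inverse-elem a u su eq = su , *≡1⇒≢0 {b = Λ P Q (a (+ 1)) (a (+ 0))} (trans (ℚₚ.*-comm (Λ P Q (u (+ 1)) (u (+ 0))) _)
    (trans (sym (Λ-* (a (+ 1)) (a (+ 0)) (u (+ 1)) (u (+ 0)))) (trans (cong (λ (x , y) → Λ P Q x y) eq) Λ-one)))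

  elem-nonZero : ∀ w → Elem P Q w → ¬ (w (+ 1) ≡ 0ℚ × w (+ 0) ≡ 0ℚ)
  elem-nonZero w (_ , Λ≢0) (e₁ , e₀) = Λ≢0 (trans (cong₂ (Λ P Q) e₁ e₀) (identity (ι P) (ι Q)))
    where
    identity : ∀ P Q → (0ℚ * 0ℚ - P * 0ℚ * 0ℚ) + Q * 0ℚ * 0ℚ ≡ 0ℚ
    identity = solve-∀ ℚ-ring

  -- Run forwards, the recurrence needs no division, so all terms from index 0 on stay integral.
  integral-init⇒laxton : ∀ w → Elem P Q w → ∀ a₁ a₀ → w (+ 1) ≡ ι a₁ → w (+ 0) ≡ ι a₀ → Laxton P Q w
  integral-init⇒laxton w e@(s , _) a₁ a₀ e₁ e₀ = e , + 0 , λ { (+ k) _ → proj₂ (ints k) ; -[1+ _ ] () }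
    where
    ints : ∀ k → IsInt (w (+ suc k)) × IsInt (w (+ k))
    ints zero = (a₁ , e₁) , (a₀ , e₀)
    ints (suc k) with ints k
    ... | (x , ex) , (y , ey) = (P ℤ.* x ℤ.- Q ℤ.* y , (begin
      w (+ suc (suc k))                       ≡⟨ cong (λ t → w (+ t)) (ℕₚ.+-comm k 2) ⟨
      w (+ k ℤ.+ + 2)                         ≡⟨ step w s (+ k) ⟩
      ι P * w (+ k ℤ.+ + 1) - ι Q * w (+ k)   ≡⟨ cong (λ t → ι P * w (+ t) - ι Q * w (+ k)) (ℕₚ.+-comm k 1) ⟩
      ι P * w (+ suc k) - ι Q * w (+ k)       ≡⟨ cong₂ (λ s t → ι P * s - ι Q * t) ex ey ⟩
      ι P * ι x - ι Q * ι y                   ≡⟨ cong₂ _-_ (ι-* P x) (ι-* Q y) ⟨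
      ι (P ℤ.* x) - ι (Q ℤ.* y)               ≡⟨ ι-sub (P ℤ.* x) (Q ℤ.* y) ⟨
      ι (P ℤ.* x ℤ.- Q ℤ.* y)                 ∎)) , (x , ex)
      where open ≡-Reasoning

-- Both integral pairs lie on the line through (x₁ , x₀). This is how two scalings of one sequence
-- are compared without computing the quotient of the scalars.
cross-zero : ∀ κ μ x₁ x₀ c₁ c₀ e₁ e₀ → κ * x₁ ≡ ι c₁ → κ * x₀ ≡ ι c₀ → μ * x₁ ≡ ι e₁ → μ * x₀ ≡ ι e₀ →
  c₁ ℤ.* e₀ ℤ.- c₀ ℤ.* e₁ ≡ + 0
cross-zero κ μ x₁ x₀ c₁ c₀ e₁ e₀ p₁ p₀ q₁ q₀ = ι-injective (begin
  ι (c₁ ℤ.* e₀ ℤ.- c₀ ℤ.* e₁)               ≡⟨ ι-sub (c₁ ℤ.* e₀) (c₀ ℤ.* e₁) ⟩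
  ι (c₁ ℤ.* e₀) - ι (c₀ ℤ.* e₁)             ≡⟨ cong₂ _-_ (ι-* c₁ e₀) (ι-* c₀ e₁) ⟩
  ι c₁ * ι e₀ - ι c₀ * ι e₁                 ≡⟨ cong₂ _-_ (cong₂ _*_ p₁ q₀) (cong₂ _*_ p₀ q₁) ⟨
  κ * x₁ * (μ * x₀) - κ * x₀ * (μ * x₁)     ≡⟨ identity κ μ x₁ x₀ ⟩
  0ℚ                                        ∎)
  where
  open ≡-Reasoning
  identity : ∀ κ μ x₁ x₀ → κ * x₁ * (μ * x₀) - κ * x₀ * (μ * x₁) ≡ 0ℚ
  identity = solve-∀ ℚ-ring

-- Normalised sequences at the prime p

module Reduction (P Q : ℤ) (Q≢0 : Q ≢ + 0) (p : ℕ) (pr : Prime p) (p∤Q : ¬ (+ p ∣ Q)) where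

  open Sequences P Q Q≢0
  open ModPrime p pr

  Div⇒∣ : ∀ k → Div k → + p ∣ k
  Div⇒∣ k = ∣⇒∣ᵤ {+ p} {k}

  ∣⇒Div : ∀ k → + p ∣ k → Div k
  ∣⇒Div k = ∣ᵤ⇒∣ {+ p} {k}

  ¬Div-Q : ¬ Div Q
  ¬Div-Q d = p∤Q (Div⇒∣ Q d)

  J-stable : Stable J
  J-stable = record
    { zeroˢ = J-0
    ; add = J-+
    ; scale = λ k → J-* (O-ι k)
    ; cancel = J-cancel (O-ι Q) (¬Div-Q ∘ J-ι⁻¹)
    }

  O-stable : Stable O
  O-stable = record
    { zeroˢ = J⇒O J-0
    ; add = O-+
    ; scale = λ k → O-* (O-ι k)
    -- Q is absorbed into the denominator m, which stays prime to p because p ∤ Q.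
    ; cancel = λ { {a} (m , k , ¬m , eq) → m ℤ.* Q , k , ¬Div-* ¬m ¬Div-Q ,
        trans (cong (_* a) (ι-* m Q)) (trans (ℚₚ.*-assoc (ι m) (ι Q) a) eq) }
    }

  record Normal (x : Seq) (c₁ c₀ : ℤ) : Set where
    field
      κ       : ℚ
      κ≢0     : κ ≢ 0ℚ
      init₁   : κ * x (+ 1) ≡ ι c₁
      init₀   : κ * x (+ 0) ≡ ι c₀
      coprime : Coprime c₁ c₀

    C : Seq
    C n = κ * x n

    nonZeroPair : NonZeroPair c₁ c₀
    nonZeroPair = coprime⇒nonZeroPair coprime

    coprimeRep : CoprimeRep P Q p x c₁ c₀
    coprimeRep = κ , (κ≢0 , init₁ , init₀) , coprime

    C-integral : IsSeq P Q x → ∀ n → O (C n)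
    C-integral s = Stable.spread O-stable C
      (λ n → subst O (sym (scale-isSeq κ x s n)) (Stable.zeroˢ O-stable)) (+ 0)
      (subst O (sym init₁) (O-ι c₁)) (subst O (sym init₀) (O-ι c₀))

    C-nonZero : IsSeq P Q x → ∀ n → ¬ (J (C (n ℤ.+ + 1)) × J (C n))
    C-nonZero s n (j₁ , j₀) = nonZeroPair
      (J-ι⁻¹ (subst J init₁ (all (+ 1))) , J-ι⁻¹ (subst J init₀ (all (+ 0))))
      where
      all = Stable.spread J-stable C
        (λ n → subst J (sym (scale-isSeq κ x s n)) J-0) n j₁ j₀

  open Normal

  normal : ∀ x c₁ c₀ → CoprimeRep P Q p x c₁ c₀ → Normal x c₁ c₀
  normal x c₁ c₀ (κ , (κ≢0 , e₁ , e₀) , cop) =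
    record { κ = κ ; κ≢0 = κ≢0 ; init₁ = e₁ ; init₀ = e₀ ; coprime = cop }

  normalForm : ∀ x → Elem P Q x → ∃[ c₁ ] ∃[ c₀ ] Normal x c₁ c₀
  normalForm x e =
    let (c₁ , c₀ , rep) = coprime-multiple (x (+ 1)) (x (+ 0)) (elem-nonZero x e) in c₁ , c₀ , normal x c₁ c₀ rep

  C-laxton : ∀ x → Elem P Q x → ∀ {c₁ c₀} (N : Normal x c₁ c₀) → Laxton P Q (C N)
  C-laxton x e {c₁} {c₀} N = integral-init⇒laxton (C N) (scale-elem (κ N) x (κ≢0 N) e) c₁ c₀ (init₁ N) (init₀ N)

  C-simStar : ∀ x {c₁ c₀} (N : Normal x c₁ c₀) → SimStar P Q (C N) x
  C-simStar x N = scale-simStar (κ N) x (κ≢0 N)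

  laxton-representative : ∀ w → Elem P Q w → ∃[ v ] (Laxton P Q v × SimStar P Q v w)
  laxton-representative w e = let (_ , _ , N) = normalForm w e in C N , C-laxton w e N , C-simStar w N

  -- The subgroup G

  -- The condition on all Laxton representatives is applied to one of them, the normalised sequence
  -- itself.
  GL⇒zero : ∀ x → Elem P Q x → ∀ {c₁ c₀} (N : Normal x c₁ c₀) → GL P Q p x → ∃[ j ] J (C N j)
  GL⇒zero x e N gl =
    let (j , d) = gl (C N) (C-laxton x e N) (C-simStar x N) in j , numerator⇒J (C N j) d

  -- A p-integral Laxton representative has no p in the denominator of its scaling
  -- factor, because some late term of the normalised sequence is a unit.
  zero⇒GL : ∀ x → Elem P Q x → ∀ {c₁ c₀} (N : Normal x c₁ c₀) → ∃[ j ] J (C N j) → GL P Q p x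
  zero⇒GL x (s , _) N (j , jC) v (_ , ν₀ , ints) (k , _ , ν , eq) = j ℤ.- ν , J⇒numerator (v (j ℤ.- ν)) divisible
    where
    eq-j : v (j ℤ.- ν) ≡ k * x j
    eq-j = trans (eq (j ℤ.- ν)) (cong (λ m → k * x m) (back j ν))
      where
      back : ∀ j ν → j ℤ.- ν ℤ.+ ν ≡ j
      back = ℤ-Solver.solve-∀
    -- In v n · C j = C (n + ν) · v (j - ν) the factor v n is an integer and C (n + ν) a unit, so
    -- divisibility passes from C j to v (j - ν).
    unit-term : ∀ n → ν₀ ℤ.≤ n → ¬ J (C N (n ℤ.+ ν)) → J (v (j ℤ.- ν))
    unit-term n ν₀≤n ¬J = let (z , vn) = ints n ν₀≤n in J-cancel (C-integral N s (n ℤ.+ ν)) ¬J (subst J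
      (begin
        ι z * (κ N * x j)                    ≡⟨ cong (_* (κ N * x j)) vn ⟨
        v n * (κ N * x j)                    ≡⟨ cong (_* (κ N * x j)) (eq n) ⟩
        k * x (n ℤ.+ ν) * (κ N * x j)        ≡⟨ identity k (x (n ℤ.+ ν)) (κ N) (x j) ⟩
        κ N * x (n ℤ.+ ν) * (k * x j)        ≡⟨ cong (κ N * x (n ℤ.+ ν) *_) eq-j ⟨
        κ N * x (n ℤ.+ ν) * v (j ℤ.- ν)      ∎)
      (J-* (O-ι z) jC))
      where
      open ≡-Reasoning
      identity : ∀ k a c b → k * a * (c * b) ≡ c * a * (k * b)
      identity = solve-∀ ℚ-ring
    divisible : J (v (j ℤ.- ν))
    divisible = cases (J? (C-integral N s (ν₀ ℤ.+ ν)))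
      where
      cases : Dec (J (C N (ν₀ ℤ.+ ν))) → J (v (j ℤ.- ν))
      cases (no ¬J) = unit-term ν₀ ℤₚ.≤-refl ¬J
      -- If p divides the term at ν₀ + ν, it cannot divide the next one.
      cases (yes j₀) = unit-term (ν₀ ℤ.+ + 1) (ℤₚ.i≤i+j ν₀ (+ 1))
        (λ j₁ → C-nonZero N s (ν₀ ℤ.+ ν) (subst (J ∘ C N) (swap ν₀ ν) j₁ , j₀))
        where
        swap : ∀ n ν → n ℤ.+ + 1 ℤ.+ ν ≡ n ℤ.+ ν ℤ.+ + 1
        swap = ℤ-Solver.solve-∀

  ProjEq-one : ∀ c₁ c₀ → Div c₀ → ProjEq P Q p (c₁ , c₀) (+ 1 , + 0)
  ProjEq-one c₁ c₀ d = Div⇒∣ (c₁ ℤ.* + 0 ℤ.- c₀ ℤ.* + 1) (subst Div (identity c₁ c₀) (Div-*ˡ (ℤ.- + 1) d))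
    where
    identity : ∀ c₁ c₀ → ℤ.- + 1 ℤ.* c₀ ≡ c₁ ℤ.* + 0 ℤ.- c₀ ℤ.* + 1
    identity = ℤ-Solver.solve-∀

  ProjEq-one⁻¹ : ∀ c₁ c₀ → ProjEq P Q p (c₁ , c₀) (+ 1 , + 0) → Div c₀
  ProjEq-one⁻¹ c₁ c₀ d = subst Div (identity c₁ c₀) (Div-*ˡ (ℤ.- + 1) (∣⇒Div (c₁ ℤ.* + 0 ℤ.- c₀ ℤ.* + 1) d))
    where
    identity : ∀ c₁ c₀ → ℤ.- + 1 ℤ.* (c₁ ℤ.* + 0 ℤ.- c₀ ℤ.* + 1) ≡ c₀
    identity = ℤ-Solver.solve-∀

  -- Shifting by j moves the vanishing term to index 0. The shifted sequence has a new coprime pair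
  -- (d₁ , d₀), tied to the old one by d₁ · C j = C (j + 1) · d₀; since C (j + 1) is a unit, p
  -- divides d₀.
  zero⇒InGStar : ∀ x → Elem P Q x → ∀ {c₁ c₀} (N : Normal x c₁ c₀) → ∃[ j ] J (C N j) → InGStar P Q p x
  zero⇒InGStar x e@(s , _) N (j , jC) = let (d₁ , d₀ , M) = normalForm (shift j x) (shift-elem j x e) in
    shift j x , shift-elem j x e , shift-simStar j x ,
    d₁ , d₀ , coprimeRep M , ProjEq-one d₁ d₀ (J-ι⁻¹
      (J-cancel (C-integral N s (j ℤ.+ + 1)) (λ j₁ → C-nonZero N s j (j₁ , jC)) (subst J
        (begin
          ι d₁ * (κ N * x j)                         ≡⟨ cong (_* (κ N * x j)) (init₁ M) ⟨
          κ M * x (+ 1 ℤ.+ j) * (κ N * x j)          ≡⟨ cong (λ t → κ M * t * (κ N * x j)) (at-shift x j) ⟩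
          κ M * x (j ℤ.+ + 1) * (κ N * x j)          ≡⟨ identity (κ M) (x (j ℤ.+ + 1)) (κ N) (x j) ⟩
          κ N * x (j ℤ.+ + 1) * (κ M * x j)          ≡⟨ cong (λ t → κ N * x (j ℤ.+ + 1) * (κ M * t)) (at-shift₀ x j) ⟨
          κ N * x (j ℤ.+ + 1) * (κ M * x (+ 0 ℤ.+ j)) ≡⟨ cong (κ N * x (j ℤ.+ + 1) *_) (init₀ M) ⟩
          κ N * x (j ℤ.+ + 1) * ι d₀                 ∎)
        (J-* (O-ι d₁) jC))))
    where
    open ≡-Reasoning
    identity : ∀ k a c b → k * a * (c * b) ≡ c * a * (k * b)
    identity = solve-∀ ℚ-ring

  -- The shift ν that relates v to x is the index sought: C (ν + 1) · d₀ = d₁ · C ν, where now d₁ is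
  -- the unit because p divides d₀.
  InGStar⇒zero : ∀ x → Elem P Q x → ∀ {c₁ c₀} (N : Normal x c₁ c₀) → InGStar P Q p x → ∃[ j ] J (C N j)
  InGStar⇒zero x (s , _) N (v , _ , (k , k≢0 , ν , eq) , d₁ , d₀ , rep , red) =
    ν , J-cancel (O-ι d₁) (λ j₁ → nonZeroPair M (J-ι⁻¹ j₁ , Dd₀)) (subst J
      (begin
        κ N * x (+ 1 ℤ.+ ν) * ι d₀                  ≡⟨ cong (κ N * x (+ 1 ℤ.+ ν) *_) (init₀ M) ⟨
        κ N * x (+ 1 ℤ.+ ν) * (κ M * v (+ 0))       ≡⟨ cong (λ t → κ N * x (+ 1 ℤ.+ ν) * (κ M * t)) (eq (+ 0)) ⟩
        κ N * x (+ 1 ℤ.+ ν) * (κ M * (k * x (+ 0 ℤ.+ ν)))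
          ≡⟨ identity (κ N) (x (+ 1 ℤ.+ ν)) (κ M) k (x (+ 0 ℤ.+ ν)) ⟩
        κ M * (k * x (+ 1 ℤ.+ ν)) * (κ N * x (+ 0 ℤ.+ ν))
          ≡⟨ cong (λ t → κ M * t * (κ N * x (+ 0 ℤ.+ ν))) (eq (+ 1)) ⟨
        κ M * v (+ 1) * (κ N * x (+ 0 ℤ.+ ν))       ≡⟨ cong₂ (λ a b → a * (κ N * b)) (init₁ M) (at-shift₀ x ν) ⟩
        ι d₁ * (κ N * x ν)                          ∎)
      (J-* (C-integral N s (+ 1 ℤ.+ ν)) (J-ι Dd₀)))
    where
    open ≡-Reasoning
    M : Normal v d₁ d₀
    M = normal v d₁ d₀ rep
    Dd₀ = ProjEq-one⁻¹ d₁ d₀ red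
    identity : ∀ c a m k b → c * a * (m * (k * b)) ≡ m * (k * a) * (c * b)
    identity = solve-∀ ℚ-ring

  GL⇒InGStar : ∀ w → Elem P Q w → GL P Q p w → InGStar P Q p w
  GL⇒InGStar w e gl = let (_ , _ , N) = normalForm w e in zero⇒InGStar w e N (GL⇒zero w e N gl)

  InGStar⇒GL : ∀ w → Elem P Q w → InGStar P Q p w → GL P Q p w
  InGStar⇒GL w e g = let (_ , _ , N) = normalForm w e in zero⇒GL w e N (InGStar⇒zero w e N g)

  -- The subgroup K

  Unit : ℤ → ℤ → Set
  Unit a₁ a₀ = ¬ Div (Λℤ P Q a₁ a₀)

  Λℤ-cong : ∀ {a₁ a₀ b₁ b₀} l → Div (a₁ ℤ.- l ℤ.* b₁) → Div (a₀ ℤ.- l ℤ.* b₀) →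
    Div (Λℤ P Q a₁ a₀ ℤ.- l ℤ.* l ℤ.* Λℤ P Q b₁ b₀)
  Λℤ-cong {a₁} {a₀} {b₁} {b₀} l d₁ d₀ =
    Div-comb (a₁ ℤ.+ l ℤ.* b₁ ℤ.- P ℤ.* a₀) (Q ℤ.* (a₀ ℤ.+ l ℤ.* b₀) ℤ.- P ℤ.* (l ℤ.* b₁)) d₁ d₀
      (identity P Q a₁ a₀ b₁ b₀ l)
    where
    identity : ∀ P Q a₁ a₀ b₁ b₀ l →
      ((a₁ ℤ.* a₁ ℤ.- P ℤ.* a₀ ℤ.* a₁) ℤ.+ Q ℤ.* a₀ ℤ.* a₀) ℤ.-
        l ℤ.* l ℤ.* ((b₁ ℤ.* b₁ ℤ.- P ℤ.* b₀ ℤ.* b₁) ℤ.+ Q ℤ.* b₀ ℤ.* b₀) ≡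
      (a₁ ℤ.+ l ℤ.* b₁ ℤ.- P ℤ.* a₀) ℤ.* (a₁ ℤ.- l ℤ.* b₁) ℤ.+
      (Q ℤ.* (a₀ ℤ.+ l ℤ.* b₀) ℤ.- P ℤ.* (l ℤ.* b₁)) ℤ.* (a₀ ℤ.- l ℤ.* b₀)
    identity = ℤ-Solver.solve-∀

  Unit-cong : ∀ {a₁ a₀ b₁ b₀ l} → ¬ Div l → Div (a₁ ℤ.- l ℤ.* b₁) → Div (a₀ ℤ.- l ℤ.* b₀) →
    Unit b₁ b₀ → Unit a₁ a₀
  Unit-cong {a₁} {a₀} {b₁} {b₀} {l} ¬l d₁ d₀ ub da = ¬Div-* (¬Div-* ¬l ¬l) ub
    (Div-comb (+ 1) (ℤ.- + 1) da (Λℤ-cong {a₁} {a₀} {b₁} {b₀} l d₁ d₀) (identity (Λℤ P Q a₁ a₀) (l ℤ.* l ℤ.* Λℤ P Q b₁ b₀)))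
    where
    identity : ∀ a b → b ≡ + 1 ℤ.* a ℤ.+ ℤ.- + 1 ℤ.* (a ℤ.- b)
    identity = ℤ-Solver.solve-∀

  Unit⇒nonZeroPair : ∀ {a₁ a₀} → Unit a₁ a₀ → NonZeroPair a₁ a₀
  Unit⇒nonZeroPair {a₁} {a₀} u (d₁ , d₀) = u (Div-comb (a₁ ℤ.- P ℤ.* a₀) (Q ℤ.* a₀) d₁ d₀ (identity P Q a₁ a₀))
    where
    identity : ∀ P Q a₁ a₀ → (a₁ ℤ.* a₁ ℤ.- P ℤ.* a₀ ℤ.* a₁) ℤ.+ Q ℤ.* a₀ ℤ.* a₀ ≡
      (a₁ ℤ.- P ℤ.* a₀) ℤ.* a₁ ℤ.+ Q ℤ.* a₀ ℤ.* a₀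
    identity = ℤ-Solver.solve-∀

  -- An integral initial pair with p ∤ Λ may fail to be coprime, yet it is nonzero modulo p. Hence
  -- it is proportional modulo p to the coprime pair, and Λ changes by the square of a unit.
  normal-unit : ∀ {x c₁ c₀} → Normal x c₁ c₀ → ∀ μ e₁ e₀ → μ * x (+ 1) ≡ ι e₁ → μ * x (+ 0) ≡ ι e₀ →
    Unit e₁ e₀ → Unit c₁ c₀
  normal-unit {x} {c₁} {c₀} N μ e₁ e₀ p₁ p₀ u =
    let (l , ¬l , d₁ , d₀) = proportional (nonZeroPair N) (Unit⇒nonZeroPair {e₁} {e₀} u) (subst Div
          (sym (cross-zero (κ N) μ (x (+ 1)) (x (+ 0)) c₁ c₀ e₁ e₀ (init₁ N) (init₀ N) p₁ p₀)) Div-0)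
    in Unit-cong {c₁} {c₀} {e₁} {e₀} ¬l d₁ d₀ u

  InGFp⇒Unit : ∀ a₁ a₀ → InGFp P Q p (a₁ , a₀) → Unit a₁ a₀
  InGFp⇒Unit a₁ a₀ g d = g (Div⇒∣ (Λℤ P Q a₁ a₀) d)

  Unit⇒InGFp : ∀ a₁ a₀ → Unit a₁ a₀ → InGFp P Q p (a₁ , a₀)
  Unit⇒InGFp a₁ a₀ u d = u (∣⇒Div (Λℤ P Q a₁ a₀) d)

  InK⇒Unit : ∀ {x c₁ c₀} → Normal x c₁ c₀ → InK P Q p x → Unit c₁ c₀
  InK⇒Unit {x} N (e₁ , e₀ , (μ , (_ , p₁ , p₀) , _) , g) = normal-unit N μ e₁ e₀ p₁ p₀ (InGFp⇒Unit e₁ e₀ g)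

  Unit⇒InK : ∀ {x c₁ c₀} → Normal x c₁ c₀ → Unit c₁ c₀ → InK P Q p x
  Unit⇒InK {x} {c₁} {c₀} N u = c₁ , c₀ , coprimeRep N , Unit⇒InGFp c₁ c₀ u

  KL⇒InKStar : ∀ w → KL P Q p w → InKStar P Q p w
  KL⇒InKStar w (v , (e , _) , v∼w , a₁ , a₀ , p₁ , p₀ , u) = let (_ , _ , N) = normalForm v e in
    v , e , v∼w , Unit⇒InK N (normal-unit N 1ℚ a₁ a₀
    (trans (ℚₚ.*-identityˡ _) p₁) (trans (ℚₚ.*-identityˡ _) p₀) (InGFp⇒Unit a₁ a₀ u))

  InKStar⇒KL : ∀ w → InKStar P Q p w → KL P Q p w
  InKStar⇒KL w (v , e , v∼w , c₁ , c₀ , rep , u) =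
    C N , C-laxton v e N , simStar-trans (C N) v w (C-simStar v N) v∼w , c₁ , c₀ , init₁ N , init₀ N , u
    where N = normal v c₁ c₀ rep

  -- If p divided Λ at index 0, it would divide Λ at every index. Where C j vanishes modulo p, Λ is
  -- congruent to the square of C (j + 1), which is a unit.
  zero⇒Unit : ∀ x → IsSeq P Q x → ∀ {c₁ c₀} (N : Normal x c₁ c₀) → ∃[ j ] J (C N j) → Unit c₁ c₀
  zero⇒Unit x s {c₁} {c₀} N (j , j₀) d = ¬j₁ (J-cancel o₁ ¬j₁ (J-comb (O-ι (+ 1))
      (O-+ (O-* (O-ι P) o₁) (O-* (O-ι (ℤ.- + 1)) (O-* (O-ι Q) (C-integral N s j))))
      jΛ j₀ (identity (ι P) (ι Q) (C N (j ℤ.+ + 1)) (C N j))))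
    where
    o₁ = C-integral N s (j ℤ.+ + 1)
    ¬j₁ : ¬ J (C N (j ℤ.+ + 1))
    ¬j₁ j₁ = C-nonZero N s j (j₁ , j₀)
    jΛ : J (Λ P Q (C N (j ℤ.+ + 1)) (C N j))
    jΛ = Stable.Λ-spread J-stable (C N) (scale-isSeq (κ N) x s) (+ 0)
      (subst J (trans (ι-Λ c₁ c₀) (sym (cong₂ (Λ P Q) (init₁ N) (init₀ N)))) (J-ι d)) j
    identity : ∀ P Q a b → a * a ≡ 1ℚ * ((a * a - P * b * a) + Q * b * b) + (P * a + - 1ℚ * (Q * b)) * b
    identity = solve-∀ ℚ-ring

  Div⇒Unit : ∀ {c₁ c₀} → Div c₀ → NonZeroPair c₁ c₀ → Unit c₁ c₀
  Div⇒Unit {c₁} {c₀} d₀ nz dΛ = nz ([ (λ d → d) , (λ d → d) ]′ (Div-euclid c₁ c₁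
      (Div-comb (+ 1) (P ℤ.* c₁ ℤ.- Q ℤ.* c₀) dΛ d₀ (identity P Q c₁ c₀))) , d₀)
    where
    identity : ∀ P Q a b → a ℤ.* a ≡ + 1 ℤ.* ((a ℤ.* a ℤ.- P ℤ.* b ℤ.* a) ℤ.+ Q ℤ.* b ℤ.* b) ℤ.+ (P ℤ.* a ℤ.- Q ℤ.* b) ℤ.* b
    identity = ℤ-Solver.solve-∀

  InGStar⇒InKStar : ∀ w → InGStar P Q p w → InKStar P Q p w
  InGStar⇒InKStar w (v , e , v∼w , c₁ , c₀ , rep , red) = v , e , v∼w ,
    Unit⇒InK N (Div⇒Unit {c₁} {c₀} (ProjEq-one⁻¹ c₁ c₀ red) (nonZeroPair N))
    where N = normal v c₁ c₀ rep

  -- The subgroup H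

  -- The inverse of b₁ + b₀ t is its conjugate (b₁ - P b₀) - b₀ t divided by the norm Λ(b).
  -- Multiplying the normalising factor of b by Λ(b) therefore clears the inverse to the conjugate
  -- of (c₁ , c₀), which is again coprime.
  normal-inverse : ∀ a b → Elem P Q b → mulInit P Q (init P Q a) (init P Q b) ≡ (1ℚ , 0ℚ) →
    ∀ {c₁ c₀} → Normal b c₁ c₀ → Normal a (c₁ ℤ.- P ℤ.* c₀) (ℤ.- c₀)
  normal-inverse a b (_ , Λ≢0) ab≡1 {c₁} {c₀} N = record
    { κ = κ N * Λ P Q b₁ b₀
    ; κ≢0 = *-≢0 (κ≢0 N) Λ≢0
    ; init₁ = begin
        κ N * Λ P Q b₁ b₀ * a₁          ≡⟨ id₁ (ι P) (ι Q) (κ N) a₁ a₀ b₁ b₀ ⟩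
        κ N * (m₁ * (b₁ - ι P * b₀) + ι Q * m₀ * b₀)
          ≡⟨ cong₂ (λ s t → κ N * (s * (b₁ - ι P * b₀) + ι Q * t * b₀)) (cong proj₁ ab≡1) (cong proj₂ ab≡1) ⟩
        κ N * (1ℚ * (b₁ - ι P * b₀) + ι Q * 0ℚ * b₀) ≡⟨ id₂ (ι P) (ι Q) (κ N) b₁ b₀ ⟩
        κ N * b₁ - ι P * (κ N * b₀)     ≡⟨ cong₂ (λ s t → s - ι P * t) (init₁ N) (init₀ N) ⟩
        ι c₁ - ι P * ι c₀               ≡⟨ cong (_-_ (ι c₁)) (ι-* P c₀) ⟨
        ι c₁ - ι (P ℤ.* c₀)             ≡⟨ ι-sub c₁ (P ℤ.* c₀) ⟨
        ι (c₁ ℤ.- P ℤ.* c₀)             ∎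
    ; init₀ = begin
        κ N * Λ P Q b₁ b₀ * a₀          ≡⟨ id₃ (ι P) (ι Q) (κ N) a₁ a₀ b₁ b₀ ⟩
        κ N * (m₀ * b₁ - m₁ * b₀)       ≡⟨ cong₂ (λ s t → κ N * (t * b₁ - s * b₀)) (cong proj₁ ab≡1) (cong proj₂ ab≡1) ⟩
        κ N * (0ℚ * b₁ - 1ℚ * b₀)       ≡⟨ id₄ (κ N) b₁ b₀ ⟩
        - (κ N * b₀)                    ≡⟨ cong -_ (init₀ N) ⟩
        - ι c₀                          ≡⟨ ι-neg c₀ ⟨
        ι (ℤ.- c₀)                      ∎
    ; coprime = λ {i} (d₁ , d₀) → coprime N (∣⇒∣ᵤ {+ i} {c₁} (Signed.∣m+n∣n⇒∣m {m = c₁} {n = ℤ.- (P ℤ.* c₀)}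
          (∣ᵤ⇒∣ {+ i} {c₁ ℤ.- P ℤ.* c₀} d₁)
          (Signed.∣m⇒∣-m (Signed.∣n⇒∣m*n P {c₀} (neg-div (∣ᵤ⇒∣ {+ i} {ℤ.- c₀} d₀))))) ,
        ∣⇒∣ᵤ {+ i} {c₀} (neg-div (∣ᵤ⇒∣ {+ i} {ℤ.- c₀} d₀)))
    }
    where
    open ≡-Reasoning
    a₁ = a (+ 1)
    a₀ = a (+ 0)
    b₁ = b (+ 1)
    b₀ = b (+ 0)
    m₁ = a₁ * b₁ - ι Q * a₀ * b₀
    m₀ = (a₀ * b₁ + a₁ * b₀) - ι P * a₀ * b₀
    neg-div : ∀ {i} → i Signed.∣ (ℤ.- c₀) → i Signed.∣ c₀
    neg-div {i} d = subst (i Signed.∣_) (ℤₚ.neg-involutive c₀) (Signed.∣m⇒∣-m d)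
    id₁ : ∀ P Q k a₁ a₀ b₁ b₀ → k * ((b₁ * b₁ - P * b₀ * b₁) + Q * b₀ * b₀) * a₁ ≡
      k * ((a₁ * b₁ - Q * a₀ * b₀) * (b₁ - P * b₀) + Q * ((a₀ * b₁ + a₁ * b₀) - P * a₀ * b₀) * b₀)
    id₁ = solve-∀ ℚ-ring
    id₂ : ∀ P Q k b₁ b₀ → k * (1ℚ * (b₁ - P * b₀) + Q * 0ℚ * b₀) ≡ k * b₁ - P * (k * b₀)
    id₂ = solve-∀ ℚ-ring
    id₃ : ∀ P Q k a₁ a₀ b₁ b₀ → k * ((b₁ * b₁ - P * b₀ * b₁) + Q * b₀ * b₀) * a₀ ≡
      k * (((a₀ * b₁ + a₁ * b₀) - P * a₀ * b₀) * b₁ - (a₁ * b₁ - Q * a₀ * b₀) * b₀)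
    id₃ = solve-∀ ℚ-ring
    id₄ : ∀ k b₁ b₀ → k * (0ℚ * b₁ - 1ℚ * b₀) ≡ - (k * b₀)
    id₄ = solve-∀ ℚ-ring

  -- Conjugate elements have the same norm.
  Unit-conjugate : ∀ {c₁ c₀} → Unit c₁ c₀ → Unit (c₁ ℤ.- P ℤ.* c₀) (ℤ.- c₀)
  Unit-conjugate {c₁} {c₀} u d = u (subst Div (identity P Q c₁ c₀) d)
    where
    identity : ∀ P Q c₁ c₀ → let a₁ = c₁ ℤ.- P ℤ.* c₀
                                 a₀ = ℤ.- c₀ in
      (a₁ ℤ.* a₁ ℤ.- P ℤ.* a₀ ℤ.* a₁) ℤ.+ Q ℤ.* a₀ ℤ.* a₀ ≡
      (c₁ ℤ.* c₁ ℤ.- P ℤ.* c₀ ℤ.* c₁) ℤ.+ Q ℤ.* c₀ ℤ.* c₀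
    identity = ℤ-Solver.solve-∀

  InG-inverse : ∀ a b → Elem P Q b → mulInit P Q (init P Q a) (init P Q b) ≡ (1ℚ , 0ℚ) → InG P Q p b → InG P Q p a
  InG-inverse a b e ab≡1 (c₁ , c₀ , rep , red) = c₁ ℤ.- P ℤ.* c₀ , ℤ.- c₀ ,
    coprimeRep (normal-inverse a b e ab≡1 (normal b c₁ c₀ rep)) ,
    ProjEq-one (c₁ ℤ.- P ℤ.* c₀) (ℤ.- c₀) (Signed.∣m⇒∣-m (ProjEq-one⁻¹ c₁ c₀ red))

  mulℤ : ℤ × ℤ → ℤ × ℤ → ℤ × ℤ
  mulℤ (a₁ , a₀) (b₁ , b₀) = a₁ ℤ.* b₁ ℤ.- Q ℤ.* a₀ ℤ.* b₀ , (a₀ ℤ.* b₁ ℤ.+ a₁ ℤ.* b₀) ℤ.- P ℤ.* a₀ ℤ.* b₀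

  powℤ : ℤ × ℤ → ℕ → ℤ × ℤ
  powℤ c zero = + 1 , + 0
  powℤ c (suc k) = mulℤ (powℤ c k) c

  ι² : ℤ × ℤ → ℚ × ℚ
  ι² (a₁ , a₀) = ι a₁ , ι a₀

  ι-mul : ∀ a b → ι² (mulℤ a b) ≡ mulInit P Q (ι² a) (ι² b)
  ι-mul (a₁ , a₀) (b₁ , b₀) = cong₂ _,_
    (trans (ι-sub (a₁ ℤ.* b₁) (Q ℤ.* a₀ ℤ.* b₀)) (cong₂ _-_ (ι-* a₁ b₁) (ι-*³ Q a₀ b₀)))
    (trans (ι-sub (a₀ ℤ.* b₁ ℤ.+ a₁ ℤ.* b₀) (P ℤ.* a₀ ℤ.* b₀)) (cong₂ _-_
      (trans (ι-+ (a₀ ℤ.* b₁) (a₁ ℤ.* b₀)) (cong₂ _+_ (ι-* a₀ b₁) (ι-* a₁ b₀))) (ι-*³ P a₀ b₀)))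

  scale² : ℚ → ℚ × ℚ → ℚ × ℚ
  scale² k (a₁ , a₀) = k * a₁ , k * a₀

  scale-mul : ∀ k l a b → mulInit P Q (scale² k a) (scale² l b) ≡ scale² (k * l) (mulInit P Q a b)
  scale-mul k l (a₁ , a₀) (b₁ , b₀) = cong₂ _,_ (id₁ (ι Q) k l a₁ a₀ b₁ b₀) (id₀ (ι P) k l a₁ a₀ b₁ b₀)
    where
    id₁ : ∀ Q k l a₁ a₀ b₁ b₀ → k * a₁ * (l * b₁) - Q * (k * a₀) * (l * b₀) ≡ k * l * (a₁ * b₁ - Q * a₀ * b₀)
    id₁ = solve-∀ ℚ-ring
    id₀ : ∀ P k l a₁ a₀ b₁ b₀ → (k * a₀ * (l * b₁) + k * a₁ * (l * b₀)) - P * (k * a₀) * (l * b₀) ≡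
      k * l * ((a₀ * b₁ + a₁ * b₀) - P * a₀ * b₀)
    id₀ = solve-∀ ℚ-ring

  -- The multiplier constructed is the k-th power of κ. Only its existence is recorded, since
  -- `cross-zero` eliminates it.
  powI-integral : ∀ κ a c → scale² κ a ≡ ι² c → ∀ k → ∃[ μ ] scale² μ (powI a k) ≡ ι² (powℤ c k)
  powI-integral κ a c eq zero = 1ℚ , refl
  powI-integral κ a c eq (suc k) = let (μ , eq') = powI-integral κ a c eq k in μ * κ , (begin
    scale² (μ * κ) (mulInit P Q (powI a k) a)         ≡⟨ scale-mul μ κ (powI a k) a ⟨
    mulInit P Q (scale² μ (powI a k)) (scale² κ a)    ≡⟨ cong₂ (mulInit P Q) eq' eq ⟩
    mulInit P Q (ι² (powℤ c k)) (ι² c)                ≡⟨ ι-mul (powℤ c k) c ⟨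
    ι² (mulℤ (powℤ c k) c)                            ∎)
    where open ≡-Reasoning

  infix 4 _≋_
  _≋_ : ℤ × ℤ → ℤ × ℤ → Set
  (a₁ , a₀) ≋ (b₁ , b₀) = Div (a₁ ℤ.- b₁) × Div (a₀ ℤ.- b₀)

  -- Multiplication by the conjugate of c turns c into the integer Λ(c), which is prime to p; the
  -- cofactors are the entries of that multiplication.
  mulℤ-cancelʳ : ∀ a b {c₁ c₀} → Unit c₁ c₀ → mulℤ a (c₁ , c₀) ≋ mulℤ b (c₁ , c₀) → a ≋ b
  mulℤ-cancelʳ (a₁ , a₀) (b₁ , b₀) {c₁} {c₀} u (d₁ , d₀) =
    Div-cancelˡ u (Div-comb (c₁ ℤ.- P ℤ.* c₀) (Q ℤ.* c₀) d₁ d₀ (id₁ P Q a₁ a₀ b₁ b₀ c₁ c₀)) ,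
    Div-cancelˡ u (Div-comb (ℤ.- c₀) c₁ d₁ d₀ (id₀ P Q a₁ a₀ b₁ b₀ c₁ c₀))
    where
    id₁ : ∀ P Q a₁ a₀ b₁ b₀ c₁ c₀ →
      ((c₁ ℤ.* c₁ ℤ.- P ℤ.* c₀ ℤ.* c₁) ℤ.+ Q ℤ.* c₀ ℤ.* c₀) ℤ.* (a₁ ℤ.- b₁) ≡
      (c₁ ℤ.- P ℤ.* c₀) ℤ.* ((a₁ ℤ.* c₁ ℤ.- Q ℤ.* a₀ ℤ.* c₀) ℤ.- (b₁ ℤ.* c₁ ℤ.- Q ℤ.* b₀ ℤ.* c₀)) ℤ.+
      (Q ℤ.* c₀) ℤ.* (((a₀ ℤ.* c₁ ℤ.+ a₁ ℤ.* c₀) ℤ.- P ℤ.* a₀ ℤ.* c₀) ℤ.- ((b₀ ℤ.* c₁ ℤ.+ b₁ ℤ.* c₀) ℤ.- P ℤ.* b₀ ℤ.* c₀))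
    id₁ = ℤ-Solver.solve-∀
    id₀ : ∀ P Q a₁ a₀ b₁ b₀ c₁ c₀ →
      ((c₁ ℤ.* c₁ ℤ.- P ℤ.* c₀ ℤ.* c₁) ℤ.+ Q ℤ.* c₀ ℤ.* c₀) ℤ.* (a₀ ℤ.- b₀) ≡
      (ℤ.- c₀) ℤ.* ((a₁ ℤ.* c₁ ℤ.- Q ℤ.* a₀ ℤ.* c₀) ℤ.- (b₁ ℤ.* c₁ ℤ.- Q ℤ.* b₀ ℤ.* c₀)) ℤ.+
      c₁ ℤ.* (((a₀ ℤ.* c₁ ℤ.+ a₁ ℤ.* c₀) ℤ.- P ℤ.* a₀ ℤ.* c₀) ℤ.- ((b₀ ℤ.* c₁ ℤ.+ b₁ ℤ.* c₀) ℤ.- P ℤ.* b₀ ℤ.* c₀))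
    id₀ = ℤ-Solver.solve-∀

  powℤ-cancel : ∀ c₁ c₀ → Unit c₁ c₀ → ∀ i k → powℤ (c₁ , c₀) i ≋ powℤ (c₁ , c₀) (i ℕ.+ k) → (+ 1 , + 0) ≋ powℤ (c₁ , c₀) k
  powℤ-cancel c₁ c₀ u zero k e = e
  powℤ-cancel c₁ c₀ u (suc i) k e = powℤ-cancel c₁ c₀ u i k
    (mulℤ-cancelʳ (powℤ (c₁ , c₀) i) (powℤ (c₁ , c₀) (i ℕ.+ k)) u e)

  private instance
    p-nonZero : ℕ.NonZero p
    p-nonZero = prime⇒nonZero pr

  residue : ℤ → Fin p
  residue z = fromℕ< (n%ℕd<d z p)

  residue-≡⇒Div : ∀ a b → residue a ≡ residue b → Div (a ℤ.- b)
  residue-≡⇒Div a b eq = divides (a /ℕ p ℤ.- b /ℕ p) (begin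
    a ℤ.- b
      ≡⟨ cong₂ ℤ._-_ (a≡a%ℕn+[a/ℕn]*n a p) (a≡a%ℕn+[a/ℕn]*n b p) ⟩
    (+ (a %ℕ p) ℤ.+ a /ℕ p ℤ.* + p) ℤ.- (+ (b %ℕ p) ℤ.+ b /ℕ p ℤ.* + p)
      ≡⟨ cong (λ t → (+ (a %ℕ p) ℤ.+ a /ℕ p ℤ.* + p) ℤ.- (+ t ℤ.+ b /ℕ p ℤ.* + p)) (sym %-eq) ⟩
    (+ (a %ℕ p) ℤ.+ a /ℕ p ℤ.* + p) ℤ.- (+ (a %ℕ p) ℤ.+ b /ℕ p ℤ.* + p)
      ≡⟨ identity (+ (a %ℕ p)) (a /ℕ p) (b /ℕ p) (+ p) ⟩
    (a /ℕ p ℤ.- b /ℕ p) ℤ.* + p ∎)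
    where
    open ≡-Reasoning
    %-eq : a %ℕ p ≡ b %ℕ p
    %-eq = Finₚ.fromℕ<-injective (a %ℕ p) (b %ℕ p) (n%ℕd<d a p) (n%ℕd<d b p) eq
    identity : ∀ r x y p → (r ℤ.+ x ℤ.* p) ℤ.- (r ℤ.+ y ℤ.* p) ≡ (x ℤ.- y) ℤ.* p
    identity = ℤ-Solver.solve-∀

  -- The exponents 0, ..., p² outnumber the p² residue pairs, so two powers i < j agree; cancelling
  -- the i-th leaves the exponent j - i = k + 1.
  finite-order : ∀ c₁ c₀ → Unit c₁ c₀ → ∃[ k ] (+ 1 , + 0) ≋ powℤ (c₁ , c₀) (suc k)
  finite-order c₁ c₀ u =
    let (i , j , i<j , eq) = Finₚ.pigeonhole (ℕₚ.n<1+n (p ℕ.* p)) code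
        (eq₁ , eq₀) = Finₚ.combine-injective (code₁ i) (code₀ i) (code₁ j) (code₀ j) eq
        (k , i+k≡j) = ℕₚ.m≤n⇒∃[o]m+o≡n i<j
    in k , powℤ-cancel c₁ c₀ u (toℕ i) (suc k)
      (subst (λ t → pow (toℕ i) ≋ pow t) (trans (sym i+k≡j) (sym (ℕₚ.+-suc (toℕ i) k)))
        (residue-≡⇒Div (proj₁ (pow (toℕ i))) (proj₁ (pow (toℕ j))) eq₁ ,
         residue-≡⇒Div (proj₂ (pow (toℕ i))) (proj₂ (pow (toℕ j))) eq₀))
    where
    pow = powℤ (c₁ , c₀)
    code₁ code₀ : Fin (suc (p ℕ.* p)) → Fin p
    code₁ i = residue (proj₁ (pow (toℕ i)))
    code₀ i = residue (proj₂ (pow (toℕ i)))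
    code : Fin (suc (p ℕ.* p)) → Fin (p ℕ.* p)
    code i = combine (code₁ i) (code₀ i)

  InG-power : ∀ u {c₁ c₀} → Normal u c₁ c₀ → Unit c₁ c₀ →
    ∃[ k ] (∀ U → Elem P Q U → init P Q U ≡ powI (init P Q u) (suc k) → InG P Q p U)
  InG-power u {c₁} {c₀} N unit = k , inG
    where
    k = proj₁ (finite-order c₁ c₀ unit)
    d₁ = proj₁ (proj₂ (finite-order c₁ c₀ unit))
    d₀ = proj₂ (proj₂ (finite-order c₁ c₀ unit))
    e₁ = proj₁ (powℤ (c₁ , c₀) (suc k))
    e₀ = proj₂ (powℤ (c₁ , c₀) (suc k))
    -- The coprime pair a of U and the power e have determinant zero, and e ≡ (1 , 0) modulo p;
    -- hence a₀ ≡ a₀ e₁ = a₁ e₀ ≡ 0.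
    identity : ∀ a₁ a₀ e₁ e₀ → a₀ ≡ ((ℤ.- a₁) ℤ.* (+ 0 ℤ.- e₀) ℤ.+ a₀ ℤ.* (+ 1 ℤ.- e₁)) ℤ.- (a₁ ℤ.* e₀ ℤ.- a₀ ℤ.* e₁)
    identity = ℤ-Solver.solve-∀
    inG : ∀ U → Elem P Q U → init P Q U ≡ powI (init P Q u) (suc k) → InG P Q p U
    inG U eU eq =
      let (a₁ , a₀ , M) = normalForm U eU
          (μ , eq') = powI-integral (κ N) (init P Q u) (c₁ , c₀) (cong₂ _,_ (init₁ N) (init₀ N)) (suc k)
          eqU = trans (cong (scale² μ) eq) eq'
          cross = cross-zero (κ M) μ (U (+ 1)) (U (+ 0)) a₁ a₀ e₁ e₀ (init₁ M) (init₀ M)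
                    (cong proj₁ eqU) (cong proj₂ eqU)
      in a₁ , a₀ , coprimeRep M , ProjEq-one a₁ a₀ (subst Div (sym (identity a₁ a₀ e₁ e₀))
           (Div-sub (Div-+ (Div-*ˡ (ℤ.- a₁) d₀) (Div-*ˡ a₀ d₁)) (subst Div (sym cross) Div-0)))

  GL⇒Unit : ∀ u → Elem P Q u → ∀ {c₁ c₀} (N : Normal u c₁ c₀) → GL P Q p u → Unit c₁ c₀
  GL⇒Unit u e N gl = zero⇒Unit u (proj₁ e) N (GL⇒zero u e N gl)

  Unit⇒InHStar : ∀ w → Elem P Q w → ∀ k u → IsSeq P Q u → PowN P Q w (suc k) u →
    ∀ {c₁ c₀} → Normal u c₁ c₀ → Unit c₁ c₀ → InHStar P Q p w
  Unit⇒InHStar w e k u su pow N unit =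
    let (l , inG) = InG-power u N unit
        -- The exponent k + 1 leads from w to u, and l + 1 from u into the kernel of reduction.
        m = suc l ℕ.* suc k
        (U , sU , powU) = powN-exists w m
    in w , e , simStar-refl w , + m , (λ ()) , U , sU , powU ,
      inG U (powN-elem w e m U sU powU)
        (trans (powN-init w m U powU) (trans (powI-* (init P Q w) (suc k) (suc l))
          (cong (λ a → powI a (suc l)) (sym (powN-init w (suc k) u pow)))))

  HL⇒InHStar : ∀ w → Elem P Q w → HL P Q p w → InHStar P Q p w
  HL⇒InHStar w e (+ zero , n≢0 , _) = contradiction refl n≢0
  HL⇒InHStar w e (+ suc k , _ , u , su , pow , gl) =
    let eu = powN-elem w e (suc k) u su pow
        (_ , _ , N) = normalForm u eu
    in Unit⇒InHStar w e k u su pow N (GL⇒Unit u eu N gl)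
  -- Here u' is the positive power and u its inverse. Unitness passes from u to u' by conjugation,
  -- so a positive exponent suffices again.
  HL⇒InHStar w e (-[1+ k ] , _ , u , su , (u' , su' , pow , u'u≡1) , gl) =
    let eu = inverse-elem u' u su u'u≡1
        (c₁ , c₀ , N) = normalForm u eu
    in Unit⇒InHStar w e k u' su' pow (normal-inverse u' u eu u'u≡1 N)
      (Unit-conjugate {c₁} {c₀} (GL⇒Unit u eu N gl))

  InG⇒HL : ∀ w → Elem P Q w → ∀ v → Elem P Q v → SimStar P Q v w →
    ∀ k u → IsSeq P Q u → PowN P Q v (suc k) u → InG P Q p u → HL P Q p w
  InG⇒HL w e v ev v∼w k u su pow g =
    let (u* , su* , pow* , u∼u*) = powN-simStar v w (proj₁ ev) (proj₁ e) v∼w (suc k) u su pow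
    in + suc k , (λ ()) , u* , su* , pow* ,
      InGStar⇒GL u* (powN-elem w e (suc k) u* su* pow*) (u , powN-elem v ev (suc k) u su pow , u∼u* , g)

  InHStar⇒HL : ∀ w → Elem P Q w → InHStar P Q p w → HL P Q p w
  InHStar⇒HL w e (v , ev , v∼w , + zero , n≢0 , _) = contradiction refl n≢0
  InHStar⇒HL w e (v , ev , v∼w , + suc k , _ , u , su , pow , g) = InG⇒HL w e v ev v∼w k u su pow g
  InHStar⇒HL w e (v , ev , v∼w , -[1+ k ] , _ , u , su , (u' , su' , pow , u'u≡1) , g) =
    InG⇒HL w e v ev v∼w k u' su' pow (InG-inverse u' u (inverse-elem u' u su u'u≡1) u'u≡1 g)

  -- The reduction map to G*_{𝔽ₚ}(f)

  recℤ : (ℤ → ℤ) → ℤ → ℤ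
  recℤ r n = (r (n ℤ.+ + 2) ℤ.- P ℤ.* r (n ℤ.+ + 1)) ℤ.+ Q ℤ.* r n

  ι-rec : ∀ r n → ι (recℤ r n) ≡ rec (ι ∘ r) n
  ι-rec r n = trans (ι-+ (r (n ℤ.+ + 2) ℤ.- P ℤ.* r (n ℤ.+ + 1)) (Q ℤ.* r n)) (cong₂ _+_
    (trans (ι-sub (r (n ℤ.+ + 2)) (P ℤ.* r (n ℤ.+ + 1))) (cong (_-_ (ι (r (n ℤ.+ + 2)))) (ι-* P (r (n ℤ.+ + 1)))))
    (ι-* Q (r n)))

  -- Regarded in ℚ, a sequence over 𝔽ₚ satisfies the recurrence modulo the ideal, which makes
  -- `Stable.spread` available for it.
  isSeqFp⇒J : ∀ r → IsSeqFp P Q p r → ∀ n → J (rec (ι ∘ r) n)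
  isSeqFp⇒J r s n = subst J (ι-rec r n) (J-ι (∣⇒Div (recℤ r n) (s n)))

  Div-spread : ∀ r → IsSeqFp P Q p r → ∀ a → Div (r (a ℤ.+ + 1)) → Div (r a) → ∀ n → Div (r n)
  Div-spread r s a d₁ d₀ n = J-ι⁻¹ (Stable.spread J-stable (ι ∘ r) (isSeqFp⇒J r s) a (J-ι d₁) (J-ι d₀) n)

  isSeqFp-scale : ∀ h r → IsSeqFp P Q p r → IsSeqFp P Q p (λ n → h ℤ.* r n)
  isSeqFp-scale h r s n = Div⇒∣ (recℤ (λ m → h ℤ.* r m) n)
    (subst Div (identity P Q h (r (n ℤ.+ + 2)) (r (n ℤ.+ + 1)) (r n)) (Div-*ˡ h (∣⇒Div (recℤ r n) (s n))))
    where
    identity : ∀ P Q h c b a → h ℤ.* ((c ℤ.- P ℤ.* b) ℤ.+ Q ℤ.* a) ≡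
      (h ℤ.* c ℤ.- P ℤ.* (h ℤ.* b)) ℤ.+ Q ℤ.* (h ℤ.* a)
    identity = ℤ-Solver.solve-∀

  isSeqFp-shift : ∀ ν r → IsSeqFp P Q p r → IsSeqFp P Q p (λ n → r (n ℤ.+ ν))
  isSeqFp-shift ν r s n = subst₂ (λ a b → + p ∣ ((r a ℤ.- P ℤ.* r b) ℤ.+ Q ℤ.* r (n ℤ.+ ν)))
    (swap n (+ 2) ν) (swap n (+ 1) ν) (s (n ℤ.+ ν))
    where
    swap : ∀ n k ν → n ℤ.+ ν ℤ.+ k ≡ n ℤ.+ k ℤ.+ ν
    swap = ℤ-Solver.solve-∀

  isSeqFp-sub : ∀ r s → IsSeqFp P Q p r → IsSeqFp P Q p s → IsSeqFp P Q p (λ n → r n ℤ.- s n)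
  isSeqFp-sub r s sr ss n = Div⇒∣ (recℤ (λ m → r m ℤ.- s m) n)
    (subst Div (identity P Q (r (n ℤ.+ + 2)) (r (n ℤ.+ + 1)) (r n) (s (n ℤ.+ + 2)) (s (n ℤ.+ + 1)) (s n))
      (Div-sub (∣⇒Div (recℤ r n) (sr n)) (∣⇒Div (recℤ s n) (ss n))))
    where
    identity : ∀ P Q c b a c' b' a' →
      ((c ℤ.- P ℤ.* b) ℤ.+ Q ℤ.* a) ℤ.- ((c' ℤ.- P ℤ.* b') ℤ.+ Q ℤ.* a') ≡
      ((c ℤ.- c') ℤ.- P ℤ.* (b ℤ.- b')) ℤ.+ Q ℤ.* (a ℤ.- a')
    identity = ℤ-Solver.solve-∀

  simStarFp-init : ∀ r s → IsSeqFp P Q p r → IsSeqFp P Q p s → ∀ l → ¬ Div l → ∀ ν →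
    Div (r (+ 1) ℤ.- l ℤ.* s (+ 1 ℤ.+ ν)) → Div (r (+ 0) ℤ.- l ℤ.* s (+ 0 ℤ.+ ν)) → SimStarFp P Q p r s
  simStarFp-init r s sr ss l ¬l ν d₁ d₀ = l , ¬l ∘ ∣⇒Div l , ν , λ n → Div⇒∣ (r n ℤ.- l ℤ.* s (n ℤ.+ ν))
    (Div-spread (λ m → r m ℤ.- l ℤ.* s (m ℤ.+ ν))
      (isSeqFp-sub r (λ m → l ℤ.* s (m ℤ.+ ν)) sr (isSeqFp-scale l (λ m → s (m ℤ.+ ν)) (isSeqFp-shift ν s ss)))
      (+ 0) d₁ d₀ n)

  simStarFp-cross : ∀ r s → IsSeqFp P Q p r → IsSeqFp P Q p s → ∀ ν →
    NonZeroPair (r (+ 1)) (r (+ 0)) → NonZeroPair (s (+ 1 ℤ.+ ν)) (s (+ 0 ℤ.+ ν)) →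
    Div (r (+ 1) ℤ.* s (+ 0 ℤ.+ ν) ℤ.- r (+ 0) ℤ.* s (+ 1 ℤ.+ ν)) → SimStarFp P Q p r s
  simStarFp-cross r s sr ss ν nr ns cross =
    let (l , ¬l , d₁ , d₀) = proportional nr ns cross in simStarFp-init r s sr ss l ¬l ν d₁ d₀

  nonZeroPair-cong : ∀ {a₁ a₀ b₁ b₀} → Div (a₁ ℤ.- b₁) → Div (a₀ ℤ.- b₀) → NonZeroPair b₁ b₀ → NonZeroPair a₁ a₀
  nonZeroPair-cong {a₁} {a₀} {b₁} {b₀} d₁ d₀ nz (e₁ , e₀) =
    nz (subst Div (identity a₁ b₁) (Div-sub e₁ d₁) , subst Div (identity a₀ b₀) (Div-sub e₀ d₀))
    where
    identity : ∀ a b → a ℤ.- (a ℤ.- b) ≡ b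
    identity = ℤ-Solver.solve-∀

  nonZeroPair-at : ∀ r → IsSeqFp P Q p r → NonZeroPair (r (+ 1)) (r (+ 0)) → ∀ n → NonZeroPair (r (n ℤ.+ + 1)) (r n)
  nonZeroPair-at r s nz n (d₁ , d₀) = nz (Div-spread r s n d₁ d₀ (+ 1) , Div-spread r s n d₁ d₀ (+ 0))

  -- The difference satisfies the recurrence modulo the ideal and lies in it at indices 0 and 1.
  -- This extends the agreement of r with C to negative indices, where C may be fractional.
  reduces : ∀ x → IsSeq P Q x → ∀ {c₁ c₀} (N : Normal x c₁ c₀) → ∀ r → IsSeqFp P Q p r →
    Div (r (+ 1) ℤ.- c₁) → Div (r (+ 0) ℤ.- c₀) → ∀ n → J (ι (r n) - C N n)
  reduces x s {c₁} {c₀} N r sr d₁ d₀ = Stable.spread J-stable (λ n → ι (r n) - C N n)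
    (λ n → subst J
      (trans (trans (sym (ℚₚ.+-identityʳ _)) (cong (λ t → rec (ι ∘ r) n - t) (sym (scale-isSeq (κ N) x s n))))
        (sym (rec-sub (ι ∘ r) (C N) n)))
      (isSeqFp⇒J r sr n))
    (+ 0)
    (subst J (trans (ι-sub (r (+ 1)) c₁) (cong (_-_ (ι (r (+ 1)))) (sym (init₁ N)))) (J-ι d₁))
    (subst J (trans (ι-sub (r (+ 0)) c₀) (cong (_-_ (ι (r (+ 0)))) (sym (init₀ N)))) (J-ι d₀))

  J-cong : ∀ {a b} → J (a - b) → J b → J a
  J-cong {a} {b} d j = J-comb (O-ι (+ 1)) (O-ι (+ 1)) d j (identity a b)
    where
    identity : ∀ a b → a ≡ 1ℚ * (a - b) + 1ℚ * b
    identity = solve-∀ ℚ-ring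

  J-congʳ : ∀ {a b} → J (a - b) → J a → J b
  J-congʳ {a} {b} d j = J-comb (O-ι (ℤ.- + 1)) (O-ι (+ 1)) d j (identity a b)
    where
    identity : ∀ a b → b ≡ - 1ℚ * (a - b) + 1ℚ * a
    identity = solve-∀ ℚ-ring

  -- The pairs of C at (1 , 0) and of C' at (1 + ν , ν) are proportional over ℚ, so their
  -- determinant is zero. Exchanging C for r and C' for r' one factor at a time alters it only by
  -- elements of the ideal.
  red-well-defined : ∀ x x' → Elem P Q x → Elem P Q x' → SimStar P Q x x' →
    ∀ r r' → RedSeq P Q p x r → RedSeq P Q p x' r' → SimStarFp P Q p r r'
  red-well-defined x x' (s , _) (s' , _) (k , _ , ν , eq) r r'
    (sr , c₁ , c₀ , rep , d₁ , d₀) (sr' , c₁' , c₀' , rep' , d₁' , d₀') =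
    simStarFp-cross r r' sr sr' ν (nonZeroPair-cong D₁ D₀ (nonZeroPair N))
      (subst (λ t → NonZeroPair (r' t) (r' (+ 0 ℤ.+ ν))) (swap ν)
        (nonZeroPair-at r' sr' (nonZeroPair-cong D₁' D₀' (nonZeroPair N')) (+ 0 ℤ.+ ν)))
      (J-ι⁻¹ (subst J
        (begin
          (ι (r' (+ 0 ℤ.+ ν)) * (ι (r (+ 1)) - C N (+ 1)) + C N (+ 1) * (ι (r' (+ 0 ℤ.+ ν)) - C N' (+ 0 ℤ.+ ν)))
            - (ι (r' (+ 1 ℤ.+ ν)) * (ι (r (+ 0)) - C N (+ 0)) + C N (+ 0) * (ι (r' (+ 1 ℤ.+ ν)) - C N' (+ 1 ℤ.+ ν)))
            ≡⟨ cong₂ (λ a b → (ι (r' (+ 0 ℤ.+ ν)) * (ι (r (+ 1)) - κ N * a) + κ N * a * (ι (r' (+ 0 ℤ.+ ν)) - C N' (+ 0 ℤ.+ ν)))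
                 - (ι (r' (+ 1 ℤ.+ ν)) * (ι (r (+ 0)) - κ N * b) + κ N * b * (ι (r' (+ 1 ℤ.+ ν)) - C N' (+ 1 ℤ.+ ν))))
                 (eq (+ 1)) (eq (+ 0)) ⟩
          _ ≡⟨ identity (κ N) (κ N') k (ι (r (+ 1))) (ι (r (+ 0))) (ι (r' (+ 1 ℤ.+ ν))) (ι (r' (+ 0 ℤ.+ ν)))
                 (x' (+ 1 ℤ.+ ν)) (x' (+ 0 ℤ.+ ν)) ⟩
          ι (r (+ 1)) * ι (r' (+ 0 ℤ.+ ν)) - ι (r (+ 0)) * ι (r' (+ 1 ℤ.+ ν))
            ≡⟨ cong₂ _-_ (ι-* (r (+ 1)) (r' (+ 0 ℤ.+ ν))) (ι-* (r (+ 0)) (r' (+ 1 ℤ.+ ν))) ⟨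
          ι (r (+ 1) ℤ.* r' (+ 0 ℤ.+ ν)) - ι (r (+ 0) ℤ.* r' (+ 1 ℤ.+ ν))
            ≡⟨ ι-sub (r (+ 1) ℤ.* r' (+ 0 ℤ.+ ν)) (r (+ 0) ℤ.* r' (+ 1 ℤ.+ ν)) ⟨
          ι (r (+ 1) ℤ.* r' (+ 0 ℤ.+ ν) ℤ.- r (+ 0) ℤ.* r' (+ 1 ℤ.+ ν)) ∎)
        (J-+ (J-+ (J-* (O-ι (r' (+ 0 ℤ.+ ν))) (R (+ 1))) (J-* (C-integral N s (+ 1)) (R' (+ 0 ℤ.+ ν))))
             (Stable.neg J-stable
               (J-+ (J-* (O-ι (r' (+ 1 ℤ.+ ν))) (R (+ 0))) (J-* (C-integral N s (+ 0)) (R' (+ 1 ℤ.+ ν))))))))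
    where
    open ≡-Reasoning
    N = normal x c₁ c₀ rep
    N' = normal x' c₁' c₀' rep'
    D₁ = ∣⇒Div (r (+ 1) ℤ.- c₁) d₁
    D₀ = ∣⇒Div (r (+ 0) ℤ.- c₀) d₀
    D₁' = ∣⇒Div (r' (+ 1) ℤ.- c₁') d₁'
    D₀' = ∣⇒Div (r' (+ 0) ℤ.- c₀') d₀'
    R = reduces x s N r sr D₁ D₀
    R' = reduces x' s' N' r' sr' D₁' D₀'
    swap : ∀ ν → + 0 ℤ.+ ν ℤ.+ + 1 ≡ + 1 ℤ.+ ν
    swap = ℤ-Solver.solve-∀
    identity : ∀ c c' k r₁ r₀ s₁ s₀ y₁ y₀ →
      (s₀ * (r₁ - c * (k * y₁)) + c * (k * y₁) * (s₀ - c' * y₀))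
        - (s₁ * (r₀ - c * (k * y₀)) + c * (k * y₀) * (s₁ - c' * y₁)) ≡ r₁ * s₀ - r₀ * s₁
    identity = solve-∀ ℚ-ring

  mulℤ-cong : ∀ a b a' b' → a ≋ a' → b ≋ b' → mulℤ a b ≋ mulℤ a' b'
  mulℤ-cong (a₁ , a₀) (b₁ , b₀) (a₁' , a₀') (b₁' , b₀') (da₁ , da₀) (db₁ , db₀) =
    subst Div (id₁ Q a₁ a₀ b₁ b₀ a₁' a₀' b₁' b₀')
      (Div-+ (Div-+ (Div-*ˡ b₁ da₁) (Div-*ˡ (ℤ.- Q ℤ.* b₀) da₀)) (Div-+ (Div-*ˡ a₁' db₁) (Div-*ˡ (ℤ.- Q ℤ.* a₀') db₀))) ,
    subst Div (id₀ P a₁ a₀ b₁ b₀ a₁' a₀' b₁' b₀')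
      (Div-+ (Div-+ (Div-*ˡ b₀ da₁) (Div-*ˡ (b₁ ℤ.- P ℤ.* b₀) da₀)) (Div-+ (Div-*ˡ a₀' db₁) (Div-*ˡ (a₁' ℤ.- P ℤ.* a₀') db₀)))
    where
    id₁ : ∀ Q a₁ a₀ b₁ b₀ a₁' a₀' b₁' b₀' →
      (b₁ ℤ.* (a₁ ℤ.- a₁') ℤ.+ ℤ.- Q ℤ.* b₀ ℤ.* (a₀ ℤ.- a₀')) ℤ.+ (a₁' ℤ.* (b₁ ℤ.- b₁') ℤ.+ ℤ.- Q ℤ.* a₀' ℤ.* (b₀ ℤ.- b₀')) ≡
      (a₁ ℤ.* b₁ ℤ.- Q ℤ.* a₀ ℤ.* b₀) ℤ.- (a₁' ℤ.* b₁' ℤ.- Q ℤ.* a₀' ℤ.* b₀')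
    id₁ = ℤ-Solver.solve-∀
    id₀ : ∀ P a₁ a₀ b₁ b₀ a₁' a₀' b₁' b₀' →
      (b₀ ℤ.* (a₁ ℤ.- a₁') ℤ.+ (b₁ ℤ.- P ℤ.* b₀) ℤ.* (a₀ ℤ.- a₀')) ℤ.+
      (a₀' ℤ.* (b₁ ℤ.- b₁') ℤ.+ (a₁' ℤ.- P ℤ.* a₀') ℤ.* (b₀ ℤ.- b₀')) ≡
      ((a₀ ℤ.* b₁ ℤ.+ a₁ ℤ.* b₀) ℤ.- P ℤ.* a₀ ℤ.* b₀) ℤ.- ((a₀' ℤ.* b₁' ℤ.+ a₁' ℤ.* b₀') ℤ.- P ℤ.* a₀' ℤ.* b₀')
    id₀ = ℤ-Solver.solve-∀

  Unit-mul : ∀ {a₁ a₀ b₁ b₀} → Unit a₁ a₀ → Unit b₁ b₀ →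
    let (m₁ , m₀) = mulℤ (a₁ , a₀) (b₁ , b₀) in Unit m₁ m₀
  Unit-mul {a₁} {a₀} {b₁} {b₀} ua ub d = ¬Div-* ua ub (subst Div (identity P Q a₁ a₀ b₁ b₀) d)
    where
    identity : ∀ P Q a₁ a₀ b₁ b₀ →
      let c₁ = a₁ ℤ.* b₁ ℤ.- Q ℤ.* a₀ ℤ.* b₀
          c₀ = (a₀ ℤ.* b₁ ℤ.+ a₁ ℤ.* b₀) ℤ.- P ℤ.* a₀ ℤ.* b₀ in
      (c₁ ℤ.* c₁ ℤ.- P ℤ.* c₀ ℤ.* c₁) ℤ.+ Q ℤ.* c₀ ℤ.* c₀ ≡
      ((a₁ ℤ.* a₁ ℤ.- P ℤ.* a₀ ℤ.* a₁) ℤ.+ Q ℤ.* a₀ ℤ.* a₀) ℤ.* ((b₁ ℤ.* b₁ ℤ.- P ℤ.* b₀ ℤ.* b₁) ℤ.+ Q ℤ.* b₀ ℤ.* b₀)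
    identity = ℤ-Solver.solve-∀

  cross-cong : ∀ a₁ a₀ b₁ b₀ c₁ c₀ e₁ e₀ → (a₁ , a₀) ≋ (c₁ , c₀) → (b₁ , b₀) ≋ (e₁ , e₀) →
    c₁ ℤ.* e₀ ℤ.- c₀ ℤ.* e₁ ≡ + 0 → Div (a₁ ℤ.* b₀ ℤ.- a₀ ℤ.* b₁)
  cross-cong a₁ a₀ b₁ b₀ c₁ c₀ e₁ e₀ (da₁ , da₀) (db₁ , db₀) cross =
    subst Div (identity a₁ a₀ b₁ b₀ c₁ c₀ e₁ e₀)
      (Div-+ (Div-sub (Div-+ (Div-*ˡ b₀ da₁) (Div-*ˡ c₁ db₀)) (Div-+ (Div-*ˡ b₁ da₀) (Div-*ˡ c₀ db₁)))
        (subst Div (sym cross) Div-0))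
    where
    identity : ∀ a₁ a₀ b₁ b₀ c₁ c₀ e₁ e₀ →
      ((b₀ ℤ.* (a₁ ℤ.- c₁) ℤ.+ c₁ ℤ.* (b₀ ℤ.- e₀)) ℤ.- (b₁ ℤ.* (a₀ ℤ.- c₀) ℤ.+ c₀ ℤ.* (b₁ ℤ.- e₁)))
        ℤ.+ (c₁ ℤ.* e₀ ℤ.- c₀ ℤ.* e₁) ≡ a₁ ℤ.* b₀ ℤ.- a₀ ℤ.* b₁
    identity = ℤ-Solver.solve-∀

  ≋-trans : ∀ a b c → a ≋ b → b ≋ c → a ≋ c
  ≋-trans (a₁ , a₀) (b₁ , b₀) (c₁ , c₀) (d₁ , d₀) (e₁ , e₀) =
    subst Div (identity a₁ b₁ c₁) (Div-+ d₁ e₁) , subst Div (identity a₀ b₀ c₀) (Div-+ d₀ e₀)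
    where
    identity : ∀ a b c → (a ℤ.- b) ℤ.+ (b ℤ.- c) ≡ a ℤ.- c
    identity = ℤ-Solver.solve-∀

  -- The product of the coprime pairs of x and y is proportional to the coprime pair of u, but need
  -- not be coprime. Membership of x and y in K makes its Λ prime to p, so it is nonzero modulo p
  -- and determines the same point.
  red-homomorphism : ∀ x y u → Prod P Q x y u → InK P Q p x → InK P Q p y →
    ∀ rx ry ru s → RedSeq P Q p x rx → RedSeq P Q p y ry → RedSeq P Q p u ru →
    IsSeqFp P Q p s → ProdFp P Q p rx ry s → SimStarFp P Q p ru s
  red-homomorphism x y u xy≡u kx ky rx ry ru s
    (_ , a₁ , a₀ , repx , x₁ , x₀) (_ , b₁ , b₀ , repy , y₁ , y₀) (sru , c₁ , c₀ , repu , u₁ , u₀) ss (s₁ , s₀) =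
    simStarFp-cross ru s sru ss (+ 0)
      (nonZeroPair-cong (proj₁ U≋) (proj₂ U≋) (nonZeroPair Nu))
      (nonZeroPair-cong (proj₁ S≋) (proj₂ S≋) (Unit⇒nonZeroPair {e₁} {e₀} (Unit-mul {a₁} {a₀} {b₁} {b₀} (InK⇒Unit Nx kx) (InK⇒Unit Ny ky))))
      (cross-cong (ru (+ 1)) (ru (+ 0)) (s (+ 1)) (s (+ 0)) c₁ c₀ e₁ e₀ U≋ S≋ (cross-zero (κ Nu) (κ Nx * κ Ny) (u (+ 1)) (u (+ 0)) c₁ c₀ e₁ e₀ (init₁ Nu) (init₀ Nu)
        (cong proj₁ prod-eq) (cong proj₂ prod-eq)))
    where
    Nx = normal x a₁ a₀ repx
    Ny = normal y b₁ b₀ repy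
    Nu = normal u c₁ c₀ repu
    e₁ = proj₁ (mulℤ (a₁ , a₀) (b₁ , b₀))
    e₀ = proj₂ (mulℤ (a₁ , a₀) (b₁ , b₀))
    U≋ : (ru (+ 1) , ru (+ 0)) ≋ (c₁ , c₀)
    U≋ = ∣⇒Div (ru (+ 1) ℤ.- c₁) u₁ , ∣⇒Div (ru (+ 0) ℤ.- c₀) u₀
    rxy = mulℤ (rx (+ 1) , rx (+ 0)) (ry (+ 1) , ry (+ 0))
    S≋ : (s (+ 1) , s (+ 0)) ≋ (e₁ , e₀)
    S≋ = ≋-trans (s (+ 1) , s (+ 0)) rxy (e₁ , e₀)
      (∣⇒Div (s (+ 1) ℤ.- proj₁ rxy) s₁ , ∣⇒Div (s (+ 0) ℤ.- proj₂ rxy) s₀)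
      (mulℤ-cong (rx (+ 1) , rx (+ 0)) (ry (+ 1) , ry (+ 0)) (a₁ , a₀) (b₁ , b₀)
        (∣⇒Div (rx (+ 1) ℤ.- a₁) x₁ , ∣⇒Div (rx (+ 0) ℤ.- a₀) x₀)
        (∣⇒Div (ry (+ 1) ℤ.- b₁) y₁ , ∣⇒Div (ry (+ 0) ℤ.- b₀) y₀))
    prod-eq : scale² (κ Nx * κ Ny) (init P Q u) ≡ ι² (e₁ , e₀)
    prod-eq = begin
      scale² (κ Nx * κ Ny) (init P Q u)                                       ≡⟨ cong (scale² (κ Nx * κ Ny)) xy≡u ⟩
      scale² (κ Nx * κ Ny) (mulInit P Q (init P Q x) (init P Q y))            ≡⟨ scale-mul (κ Nx) (κ Ny) (init P Q x) (init P Q y) ⟨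
      mulInit P Q (scale² (κ Nx) (init P Q x)) (scale² (κ Ny) (init P Q y))
        ≡⟨ cong₂ (mulInit P Q) (cong₂ _,_ (init₁ Nx) (init₀ Nx)) (cong₂ _,_ (init₁ Ny) (init₀ Ny)) ⟩
      mulInit P Q (ι² (a₁ , a₀)) (ι² (b₁ , b₀))                               ≡⟨ ι-mul (a₁ , a₀) (b₁ , b₀) ⟨
      ι² (e₁ , e₀)                                                            ∎
      where open ≡-Reasoning

  Div-sub-comm : ∀ a b → Div (a ℤ.- b) → Div (b ℤ.- a)
  Div-sub-comm a b d = subst Div (identity a b) (Signed.∣m⇒∣-m d)
    where
    identity : ∀ a b → ℤ.- (a ℤ.- b) ≡ b ℤ.- a
    identity = ℤ-Solver.solve-∀

  inverse-mod-cancel : ∀ l h t → Div (l ℤ.* h ℤ.- + 1) → Div (t ℤ.- h ℤ.* (l ℤ.* t))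
  inverse-mod-cancel l h t d = subst Div (identity l h t) (Div-*ˡ (ℤ.- t) d)
    where
    identity : ∀ l h t → ℤ.- t ℤ.* (l ℤ.* h ℤ.- + 1) ≡ t ℤ.- h ℤ.* (l ℤ.* t)
    identity = ℤ-Solver.solve-∀

  -- The integers r₁ , r₀ are lifted to a rational sequence as they stand. They need not be coprime,
  -- so the reduction is read off from a coprime pair, congruent to l times (r₁ , r₀); this is why
  -- the reduced sequence is l · r.
  red-surjective : ∀ r → ElemFp P Q p r →
    ∃[ x ] (Elem P Q x × InK P Q p x × ∃[ r' ] (RedSeq P Q p x r' × SimStarFp P Q p r r'))
  red-surjective r (sr , ¬Λ) =
    let (x , sx , eq) = seq-with-init (ι (r (+ 1))) (ι (r (+ 0)))
        e₁ = trans (ℚₚ.*-identityˡ (x (+ 1))) (cong proj₁ eq)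
        e₀ = trans (ℚₚ.*-identityˡ (x (+ 0))) (cong proj₂ eq)
        ex = sx , λ Λ≡0 → unit (subst Div (sym (ι-injective (trans (ι-Λ r₁ r₀)
               (trans (cong (λ (a , b) → Λ P Q a b) (sym eq)) Λ≡0)))) Div-0)
        (c₁ , c₀ , N) = normalForm x ex
        (l , ¬l , d₁ , d₀) = proportional (nonZeroPair N) (Unit⇒nonZeroPair {r₁} {r₀} unit)
          (subst Div (sym (cross-zero (κ N) 1ℚ (x (+ 1)) (x (+ 0)) c₁ c₀ r₁ r₀ (init₁ N) (init₀ N) e₁ e₀)) Div-0)
        (h , lh≡1) = inverse-mod ¬l
        sr' = isSeqFp-scale l r sr
    in x , ex , Unit⇒InK N (normal-unit N 1ℚ r₁ r₀ e₁ e₀ unit) , (λ n → l ℤ.* r n) ,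
      (sr' , c₁ , c₀ , coprimeRep N ,
        Div⇒∣ (l ℤ.* r₁ ℤ.- c₁) (Div-sub-comm c₁ (l ℤ.* r₁) d₁) ,
        Div⇒∣ (l ℤ.* r₀ ℤ.- c₀) (Div-sub-comm c₀ (l ℤ.* r₀) d₀)) ,
      simStarFp-init r (λ n → l ℤ.* r n) sr sr' h (¬Div-inverse {l} lh≡1) (+ 0)
        (inverse-mod-cancel l h r₁ lh≡1) (inverse-mod-cancel l h r₀ lh≡1)
    where
    r₁ = r (+ 1)
    r₀ = r (+ 0)
    unit = InGFp⇒Unit r₁ r₀ ¬Λ

  -- At index -ν the sequence r is congruent to l times the identity sequence at 0, that is, to 0.
  TrivFp⇒InGStar : ∀ x → Elem P Q x → ∀ r → RedSeq P Q p x r → TrivFp P Q p r → InGStar P Q p x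
  TrivFp⇒InGStar x e@(s , _) r (sr , c₁ , c₀ , rep , d₁ , d₀) (t , _ , (_ , t₀) , l , _ , ν , sim) =
    zero⇒InGStar x e N (ℤ.- ν , J-congʳ (R (ℤ.- ν)) (J-ι Dr))
    where
    N = normal x c₁ c₀ rep
    R = reduces x s N r sr (∣⇒Div (r (+ 1) ℤ.- c₁) d₁) (∣⇒Div (r (+ 0) ℤ.- c₀) d₀)
    identity : ∀ a l b → a ≡ + 1 ℤ.* (a ℤ.- l ℤ.* b) ℤ.+ l ℤ.* b
    identity = ℤ-Solver.solve-∀
    Dr : Div (r (ℤ.- ν))
    Dr = Div-comb (+ 1) l (∣⇒Div (r (ℤ.- ν) ℤ.- l ℤ.* t (ℤ.- ν ℤ.+ ν)) (sim (ℤ.- ν)))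
      (subst (Div ∘ t) (sym (ℤₚ.+-inverseˡ ν)) (∣⇒Div (t (+ 0)) t₀)) (identity (r (ℤ.- ν)) l (t (ℤ.- ν ℤ.+ ν)))

  InGStar⇒TrivFp : ∀ x → Elem P Q x → ∀ r → RedSeq P Q p x r → InGStar P Q p x → TrivFp P Q p r
  InGStar⇒TrivFp x e@(s , _) r (sr , c₁ , c₀ , rep , d₁ , d₀) g = E , sE ,
    (Div⇒∣ (E (+ 1) ℤ.- + 1) (subst Div E₁ inv) ,
     Div⇒∣ (E (+ 0)) (subst (λ m → Div (h ℤ.* r m)) (sym (ℤₚ.+-identityˡ j)) (Div-*ˡ h Dr))) ,
    rⱼ₊₁ , (λ d → unit (∣⇒Div rⱼ₊₁ d)) , ℤ.- j , λ n → Div⇒∣ (r n ℤ.- rⱼ₊₁ ℤ.* E (n ℤ.- j))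
      (subst (λ m → Div (r n ℤ.- rⱼ₊₁ ℤ.* (h ℤ.* r m))) (sym (back n j)) (inverse-mod-cancel h rⱼ₊₁ (r n) inv'))
    where
    N : Normal x c₁ c₀
    N = normal x c₁ c₀ rep
    D₁ = ∣⇒Div (r (+ 1) ℤ.- c₁) d₁
    D₀ = ∣⇒Div (r (+ 0) ℤ.- c₀) d₀
    vanishing : ∃[ j ] J (C N j)
    vanishing = InGStar⇒zero x e N g
    j = proj₁ vanishing
    rⱼ₊₁ = r (j ℤ.+ + 1)
    Dr : Div (r j)
    Dr = J-ι⁻¹ (J-cong (reduces x s N r sr D₁ D₀ j) (proj₂ vanishing))
    unit : ¬ Div rⱼ₊₁
    unit d = nonZeroPair-at r sr (nonZeroPair-cong D₁ D₀ (nonZeroPair N)) j (d , Dr)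
    h = proj₁ (inverse-mod unit)
    inv : Div (rⱼ₊₁ ℤ.* h ℤ.- + 1)
    inv = proj₂ (inverse-mod unit)
    inv' : Div (h ℤ.* rⱼ₊₁ ℤ.- + 1)
    inv' = subst (λ t → Div (t ℤ.- + 1)) (ℤₚ.*-comm rⱼ₊₁ h) inv
    -- Shifting by the index j of a vanishing term and dividing by the unit after it gives the
    -- initial pair (1 , 0); the scalar `rⱼ₊₁` and the shift -j lead back to r.
    E : ℤ → ℤ
    E n = h ℤ.* r (n ℤ.+ j)
    sE : IsSeqFp P Q p E
    sE = isSeqFp-scale h (λ n → r (n ℤ.+ j)) (isSeqFp-shift j r sr)
    E₁ : rⱼ₊₁ ℤ.* h ℤ.- + 1 ≡ E (+ 1) ℤ.- + 1
    E₁ = cong (ℤ._- + 1) (trans (ℤₚ.*-comm rⱼ₊₁ h) (cong (λ m → h ℤ.* r m) (ℤₚ.+-comm j (+ 1))))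
    back : ∀ n j → n ℤ.- j ℤ.+ j ≡ n
    back = ℤ-Solver.solve-∀

-- Laxton's subgroups and the exact sequence

theorem7 : (P Q : ℤ) → Q ≢ + 0 → P ℤ.* P ℤ.- + 4 ℤ.* Q ≢ + 0 →
  (p : ℕ) → Prime p → ¬ (+ p ∣ Q) →
  -- ι : G*(f) → G*_ℚ(f) is onto (every class has a Laxton representative)
  (∀ w → Elem P Q w → ∃[ v ] (Laxton P Q v × SimStar P Q v w)) ×
  -- ι(G*(f,p)_L) = G*(f,p), ι(K*(f,p)_L) = K*(f,p), ι(H*(f,p)_L) = H*(f,p)
  (∀ w → Laxton P Q w →
    (GL P Q p w ⇔ InGStar P Q p w) ×
    (KL P Q p w ⇔ InKStar P Q p w) ×
    (HL P Q p w ⇔ InHStar P Q p w)) ×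
  -- exactness of 1 → G*(f,p) → K*(f,p) → G*_{𝔽_p}(f) → 1
  -- G*(f,p) ⊆ K*(f,p)
  (∀ w → Elem P Q w → InGStar P Q p w → InKStar P Q p w) ×
  -- red_p is well defined on K*(f,p)
  (∀ x x' → Elem P Q x → Elem P Q x' → InK P Q p x → InK P Q p x' → SimStar P Q x x' →
    ∀ r r' → RedSeq P Q p x r → RedSeq P Q p x' r' → SimStarFp P Q p r r') ×
  -- red_p is a homomorphism
  (∀ x y u → Elem P Q x → Elem P Q y → IsSeq P Q u → Prod P Q x y u →
    InK P Q p x → InK P Q p y →
    ∀ rx ry ru s → RedSeq P Q p x rx → RedSeq P Q p y ry → RedSeq P Q p u ru →
    IsSeqFp P Q p s → ProdFp P Q p rx ry s → SimStarFp P Q p ru s) ×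
  -- red_p is surjective onto G*_{𝔽_p}(f)
  (∀ r → ElemFp P Q p r →
    ∃[ x ] (Elem P Q x × InK P Q p x × ∃[ r' ] (RedSeq P Q p x r' × SimStarFp P Q p r r'))) ×
  -- ker red_p = G*(f,p)
  (∀ x → Elem P Q x → InK P Q p x → ∀ r → RedSeq P Q p x r →
    (TrivFp P Q p r ⇔ InGStar P Q p x))
theorem7 P Q Q≢0 _ p pr p∤Q =
  laxton-representative ,
  (λ w (e , _) →
    mk⇔ (GL⇒InGStar w e) (InGStar⇒GL w e) ,
    mk⇔ (KL⇒InKStar w) (InKStar⇒KL w) ,
    mk⇔ (HL⇒InHStar w e) (InHStar⇒HL w e)) ,
  (λ w _ → InGStar⇒InKStar w) ,
  (λ x x' e e' _ _ → red-well-defined x x' e e') ,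
  (λ x y u _ _ _ → red-homomorphism x y u) ,
  red-surjective ,
  (λ x e _ r red → mk⇔ (TrivFp⇒InGStar x e r red) (InGStar⇒TrivFp x e r red))
  where open Reduction P Q Q≢0 p pr p∤Q
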